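{- For every integer $k\geq 3$, the odd graph $O_k=K(2k+1,k)$ has a Hamilton cycle.
   Context: For integers $k\geq 1$ and $n\geq 2k+1$, the Kneser graph $K(n,k)$ is the graph whose vertices are the $k$-element subsets of $[n]=\{1,\ldots,n\}$, two subsets being adjacent if and only if they are disjoint. The odd graph is $O_k:=K(2k+1,k)$. -}

module Defs where

open import Data.Nat using (ℕ; suc; _+_; _*_; _≤_; _<?_; s≤s)
open import Relation.Nullary using (yes; no)
open import Data.Fin using (Fin; zero; suc; toℕ; fromℕ<)
open import Data.Fin.Subset using (Subset; ∣_∣; _∩_; Empty)
open import Data.Product using (Σ; _×_; _,_; proj₁)
open import Relation.Binary.PropositionalEquality using (_≡_)

record Graph : Set₁ where
  field
    Vertex : Set
    Adj    : Vertex → Vertex → Set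

cyclicSuc : ∀ {m} → Fin m → Fin m
cyclicSuc {suc m} i with suc (toℕ i) <? suc m
... | yes p = fromℕ< p
... | no _  = zero

record HamiltonCycle (G : Graph) : Set where
  open Graph G
  field
    len       : ℕ
    len≥3     : 3 ≤ len
    vert      : Fin len → Vertex
    injective : ∀ i j → vert i ≡ vert j → i ≡ j
    surjective : ∀ v → Σ (Fin len) (λ i → vert i ≡ v)
    adjacent  : ∀ i → Adj (vert i) (vert (cyclicSuc i))

KneserGraph : ℕ → ℕ → Graph
KneserGraph n k = record
  { Vertex = Σ (Subset n) (λ s → ∣ s ∣ ≡ k)
  ; Adj    = λ u v → Empty (proj₁ u ∩ proj₁ v)
  }

OddGraph : ℕ → Graph
OddGraph k = KneserGraph (suc (2 * k)) k

{-# OPTIONS --safe #-}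
-- Dropping one coordinate, and complementing the sets that contain it, turns O_k into the graph on the words
-- of length 2k and weight k or k + 1, where two words are joined if they differ in one bit or are complementary.
-- For every Dyck word x there is a path P x from x to its complement flipping each bit once; closed up by the
-- complementary edge, these paths partition the vertices into cycles of length 2k + 1, one for each ordered tree.
-- The cycles are merged along 6-cycles and 8-cycles that meet three or four of them in one edge each. The shape
-- of the tree around an edge determines the exchange it is used in, so no edge is needed twice, and the exchanges
-- form a hypertree on the set of all trees, built by induction on their size.
module Submission where

open import Defs
open import Data.Nat using (ℕ; _≤_)
open import Data.Bool using (Bool; true; false; not; if_then_else_; _∨_)
open import Data.Bool.Properties using (not-involutive) renaming (_≟_ to _≟ᵇ_)
open import Data.Empty using (⊥)
open import Data.Fin using (Fin; zero; suc; toℕ; fromℕ<)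
open import Data.Fin.Subset as Subset using (Subset; ∣_∣; _∩_)
open import Data.Fin.Subset.Properties using (∉⊥; ∩-comm)
open import Data.List using (List; []; _∷_; _++_; map; length; _∷ʳ_; initLast; _∷ʳ′_)
open import Data.List.Properties using (≡-dec; map-++; ++-assoc; ∷-injectiveʳ; ∷ʳ-injectiveˡ; ∷ʳ-injectiveʳ; ++-cancelˡ; ++-cancelʳ; length-++; ++-identityʳ)
open import Data.Nat using (zero; suc; _+_; _*_; _<_; z≤n; s≤s; _≤?_; _<?_)
open import Data.Nat.Induction using (<-rec)
open import Data.Nat.Properties hiding (_≟_; _≤?_; _<?_)
import Data.Nat.Properties as ℕ
open import Data.Nat.Solver using (module +-*-Solver)
open import Data.Product using (Σ; _×_; _,_; proj₁; proj₂)
open import Data.Sum as Sum using (_⊎_; inj₁; inj₂; [_,_]′)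
open import Data.Unit using (⊤; tt)
open import Data.Vec as Vec using (Vec; []; _∷_)
import Data.Vec.Properties as Vec
open import Function using (id; _∘_)
open import Relation.Binary.PropositionalEquality
open import Relation.Nullary using (¬_; Dec; yes; no; does; contradiction)
open import Relation.Nullary.Decidable using (map′; _×-dec_; _⊎-dec_; dec-true; dec-false)

-- For size 2 the two cycles cannot be joined into a Hamilton cycle, since the graph is then the
-- Petersen graph, so the induction cannot simply descend. Hence `Glue` allows mergers made in
-- advance: `X b` records one between `b ▸ leaf` and `(b ▸ ε) ▸ ε`, and with it nothing is left to
-- do for size 2. The trees not of the form `y ▸ ε` are divided into groups, one for each `a`: the
-- trees `a ▸ c` with `c` of size at least 2, and the trees `(a ▸ b) ▸ leaf`. Exchanges inside a
-- group produce the very mergers that the induction hypothesis for `c` asks for. One exchange per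
-- group also reaches a cycle of some `y ▸ ε`, and these remaining cycles are joined by induction on
-- `y`. Edges carry names, a tree and a position in it, so that removed edges are seen to be
-- distinct from constructors alone, without comparing words. Visited vertices are counted by
-- weights for arbitrary functions, so that no permutations of vertex lists occur.

infixl 5 _▸_

-- u ▸ v encodes the Dyck word u 1 v 0.
data Tree : Set where
  ε   : Tree
  _▸_ : Tree → Tree → Tree

pattern leaf = ε ▸ ε

Word : Set
Word = List Bool

word : Tree → Word
word ε       = []
word (u ▸ v) = word u ++ true ∷ (word v ++ false ∷ [])

coword : Tree → Word
coword ε       = []
coword (u ▸ v) = coword u ++ false ∷ (coword v ++ true ∷ [])

compl : Word → Word
compl = map not

compl-involutive : ∀ w → compl (compl w) ≡ w
compl-involutive []      = refl
compl-involutive (b ∷ w) = cong₂ _∷_ (not-involutive b) (compl-involutive w)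

compl-word : ∀ x → compl (word x) ≡ coword x
compl-word ε       = refl
compl-word (u ▸ v) = trans (map-++ not (word u) _) (cong₂ (λ p q → p ++ false ∷ q) (compl-word u)
  (trans (map-++ not (word v) _) (cong (_++ true ∷ []) (compl-word v))))

compl-coword : ∀ x → compl (coword x) ≡ word x
compl-coword x = trans (cong compl (sym (compl-word x))) (compl-involutive (word x))

compl-coword-++ : ∀ x w → compl (coword x ++ w) ≡ word x ++ compl w
compl-coword-++ x w = trans (map-++ not (coword x) w) (cong (_++ compl w) (compl-coword x))

infix 4 _~_

data _~_ : Word → Word → Set where
  up    : ∀ {w} → (false ∷ w) ~ (true ∷ w)
  down  : ∀ {w} → (true ∷ w) ~ (false ∷ w)
  there : ∀ {b w w′} → w ~ w′ → (b ∷ w) ~ (b ∷ w′)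

~-sym : ∀ {w w′} → w ~ w′ → w′ ~ w
~-sym up        = down
~-sym down      = up
~-sym (there p) = there (~-sym p)

~-++ˡ : ∀ r {w w′} → w ~ w′ → (r ++ w) ~ (r ++ w′)
~-++ˡ []      p = p
~-++ˡ (b ∷ r) p = there (~-++ˡ r p)

~-++ʳ : ∀ {w w′} r → w ~ w′ → (w ++ r) ~ (w′ ++ r)
~-++ʳ r up        = up
~-++ʳ r down      = down
~-++ʳ r (there p) = there (~-++ʳ r p)

~-compl : ∀ {w w′} → w ~ w′ → compl w ~ compl w′
~-compl up        = down
~-compl down      = up
~-compl (there p) = there (~-compl p)

-- The path P x runs from word x to coword x and flips every bit exactly once:
--   P (u ▸ v) = P u · 1 v 0,  then  ū 1 · (P v complemented and reversed) · 1,  then  ū 0 v̄ 1.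
embˡ : Tree → Word → Word
embˡ v s = s ++ true ∷ (word v ++ false ∷ [])

embʳ : Tree → Word → Word
embʳ u s = coword u ++ true ∷ (compl s ++ true ∷ [])

embˡ-~ : ∀ v {s s′} → s ~ s′ → embˡ v s ~ embˡ v s′
embˡ-~ v = ~-++ʳ _

embʳ-~ : ∀ u {s s′} → s ~ s′ → embʳ u s ~ embʳ u s′
embʳ-~ u p = ~-++ˡ (coword u) (there (~-++ʳ _ (~-compl p)))

-- The edge of P x that flips a given bit; close and open are the 0 and the 1 displayed in u 1 v 0.
data Edge : Set where
  close open′ : Edge
  inˡ inʳ     : Edge → Edge

source target : Tree → Edge → Word
source ε       _       = []
source (u ▸ v) close   = embˡ v (coword u)
source (u ▸ v) open′   = embʳ u (word v)
source (u ▸ v) (inˡ e) = embˡ v (source u e)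
source (u ▸ v) (inʳ e) = embʳ u (source v e)
target ε       _       = []
target (u ▸ v) close   = embʳ u (coword v)
target (u ▸ v) open′   = coword (u ▸ v)
target (u ▸ v) (inˡ e) = embˡ v (target u e)
target (u ▸ v) (inʳ e) = embʳ u (target v e)

-- Walks with named edges

Name : Set
Name = Tree × Edge

src tgt : Name → Word
src (x , e) = source x e
tgt (x , e) = target x e

-- Unordered, because merging may traverse a piece of a cycle backwards.
Ends : Name → Word → Word → Set
Ends n s t = (src n ≡ s × tgt n ≡ t) ⊎ (src n ≡ t × tgt n ≡ s)

Ends-sym : ∀ {n s t} → Ends n s t → Ends n t s
Ends-sym (inj₁ p) = inj₂ p
Ends-sym (inj₂ p) = inj₁ p

-- Only named steps can be exchanged later; complementary edges and edges brought in by an exchange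
-- are `plain`.
data Step (R : Word → Word → Set) (s t : Word) : Set where
  plain : R s t → Step R s t
  named : R s t → (n : Name) → Ends n s t → Step R s t

infixr 5 _◂_

data Path (R : Word → Word → Set) : Word → Word → Set where
  stop : ∀ w → Path R w w
  _◂_  : ∀ {s t w} → Step R s t → Path R t w → Path R s w

infix 4 _∈ᵖ_

data _∈ᵖ_ {R} (n : Name) : ∀ {s t} → Path R s t → Set where
  here  : ∀ {s t w r e} {p : Path R t w} → n ∈ᵖ (named {s = s} r n e ◂ p)
  there : ∀ {s t w} {c : Step R s t} {p : Path R t w} → n ∈ᵖ p → n ∈ᵖ (c ◂ p)

-- Taken for all `f`, this determines the multiset of visited vertices.
weight : ∀ {R} (f : Word → ℕ) {s t} → Path R s t → ℕ
weight f (stop w)        = f w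
weight f (_◂_ {s} c p) = f s + weight f p

link : ∀ {R a b c d} → Path R a b → Step R b c → Path R c d → Path R a d
link (stop _) s q = s ◂ q
link (t ◂ p)  s q = t ◂ link p s q

weight-link : ∀ {R a b c d} f (p : Path R a b) (s : Step R b c) (q : Path R c d) →
  weight f (link p s q) ≡ weight f p + weight f q
weight-link f (stop _) s q = refl
weight-link f (_◂_ {a} t p)  s q = trans (cong (f a +_) (weight-link f p s q)) (sym (+-assoc (f a) _ _))

∈-linkˡ : ∀ {R a b c d n} {p : Path R a b} {s : Step R b c} {q : Path R c d} → n ∈ᵖ p → n ∈ᵖ link p s q
∈-linkˡ here      = here
∈-linkˡ (there i) = there (∈-linkˡ i)

∈-linkʳ : ∀ {R a b c d n} (p : Path R a b) {s : Step R b c} {q : Path R c d} → n ∈ᵖ q → n ∈ᵖ link p s q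
∈-linkʳ (stop _) i = there i
∈-linkʳ (t ◂ p)  i = there (∈-linkʳ p i)

∈-link-step : ∀ {R a b c d n r e} (p : Path R a b) {q : Path R c d} → n ∈ᵖ link p (named r n e) q
∈-link-step (stop _) = here
∈-link-step (t ◂ p)  = there (∈-link-step p)

module Reverse {R : Word → Word → Set} (R-sym : ∀ {s t} → R s t → R t s) where

  flip : ∀ {s t} → Step R s t → Step R t s
  flip (plain r)     = plain (R-sym r)
  flip (named r n e) = named (R-sym r) n (Ends-sym {n} e)

  reverse : ∀ {s t} → Path R s t → Path R t s
  reverse (stop w)      = stop w
  reverse (_◂_ {s} c p) = link (reverse p) (flip c) (stop s)

  weight-reverse : ∀ f {s t} (p : Path R s t) → weight f (reverse p) ≡ weight f p
  weight-reverse f (stop w)      = refl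
  weight-reverse f (_◂_ {s} c p) = trans (weight-link f (reverse p) (flip c) (stop s))
    (trans (+-comm _ (f s)) (cong (f s +_) (weight-reverse f p)))

  ∈-reverse : ∀ {s t n} {p : Path R s t} → n ∈ᵖ p → n ∈ᵖ reverse p
  ∈-reverse {p = _ ◂ p} here      = ∈-link-step (reverse p)
  ∈-reverse             (there i) = ∈-linkˡ (∈-reverse i)

module Transport {R R′ : Word → Word → Set} (κ : Word → Word) (g : Name → Name)
  (κ-R : ∀ {s t} → R s t → R′ (κ s) (κ t))
  (src-g : ∀ n → src (g n) ≡ κ (src n)) (tgt-g : ∀ n → tgt (g n) ≡ κ (tgt n)) where

  ends : ∀ {n s t} → Ends n s t → Ends (g n) (κ s) (κ t)
  ends (inj₁ (refl , refl)) = inj₁ (src-g _ , tgt-g _)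
  ends (inj₂ (refl , refl)) = inj₂ (src-g _ , tgt-g _)

  step : ∀ {s t} → Step R s t → Step R′ (κ s) (κ t)
  step (plain r)     = plain (κ-R r)
  step (named r n e) = named (κ-R r) (g n) (ends {n} e)

  path : ∀ {s t} → Path R s t → Path R′ (κ s) (κ t)
  path (stop w) = stop (κ w)
  path (c ◂ p)  = step c ◂ path p

  weight-path : ∀ f {s t} (p : Path R s t) → weight f (path p) ≡ weight (λ w → f (κ w)) p
  weight-path f (stop w)      = refl
  weight-path f (_◂_ {s} c p) = cong (f (κ s) +_) (weight-path f p)

  ∈-path : ∀ {s t n} {p : Path R s t} → n ∈ᵖ p → g n ∈ᵖ path p
  ∈-path here      = here
  ∈-path (there i) = there (∈-path i)

module ~-Reverse = Reverse {_~_} ~-sym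
module Left (v : Tree) = Transport {_~_} {_~_} (embˡ v) (λ n → proj₁ n ▸ v , inˡ (proj₂ n)) (embˡ-~ v) (λ _ → refl) (λ _ → refl)
module Right (u : Tree) = Transport {_~_} {_~_} (embʳ u) (λ n → u ▸ proj₁ n , inʳ (proj₂ n)) (embʳ-~ u) (λ _ → refl) (λ _ → refl)

close-~ : ∀ u v → embˡ v (coword u) ~ embʳ u (coword v)
close-~ u v rewrite compl-coword v = ~-++ˡ (coword u) (there (~-++ˡ (word v) up))

open-~ : ∀ u v → embʳ u (word v) ~ coword (u ▸ v)
open-~ u v rewrite compl-word v = ~-++ˡ (coword u) down

P : ∀ x → Path _~_ (word x) (coword x)
P ε       = stop []
P (u ▸ v) = link (Left.path v (P u)) (named (close-~ u v) (u ▸ v , close) (inj₁ (refl , refl)))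
  (link (~-Reverse.reverse (Right.path u (P v))) (named (open-~ u v) (u ▸ v , open′) (inj₁ (refl , refl)))
    (stop (coword (u ▸ v))))

weight-P : ∀ f u v → weight f (P (u ▸ v)) ≡
  weight (λ w → f (embˡ v w)) (P u) + (weight (λ w → f (embʳ u w)) (P v) + f (coword (u ▸ v)))
weight-P f u v = trans (weight-link f (Left.path v (P u)) _ _) (cong₂ _+_ (Left.weight-path v f (P u))
  (trans (weight-link f (~-Reverse.reverse (Right.path u (P v))) _ _) (cong (_+ f (coword (u ▸ v)))
    (trans (~-Reverse.weight-reverse f (Right.path u (P v))) (Right.weight-path u f (P v))))))

data Valid : Tree → Edge → Set where
  close : ∀ {u v} → Valid (u ▸ v) close
  open′ : ∀ {u v} → Valid (u ▸ v) open′
  inˡ   : ∀ {u v e} → Valid u e → Valid (u ▸ v) (inˡ e)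
  inʳ   : ∀ {u v e} → Valid v e → Valid (u ▸ v) (inʳ e)

∈-P : ∀ {x e} → Valid x e → (x , e) ∈ᵖ P x
∈-P {u ▸ v} close   = ∈-link-step (Left.path v (P u))
∈-P {u ▸ v} open′   = ∈-linkʳ (Left.path v (P u)) (∈-link-step (~-Reverse.reverse (Right.path u (P v))))
∈-P {u ▸ v} (inˡ i) = ∈-linkˡ (Left.∈-path v (∈-P i))
∈-P {u ▸ v} (inʳ i) = ∈-linkʳ (Left.path v (P u)) (∈-linkˡ (~-Reverse.∈-reverse (Right.∈-path u (∈-P i))))

-- Opening and merging cycles

data Adj : Word → Word → Set where
  flip : ∀ {s t} → s ~ t → Adj s t
  comp : ∀ {s t} → t ≡ compl s → Adj s t

Adj-sym : ∀ {s t} → Adj s t → Adj t s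
Adj-sym (flip p)        = flip (~-sym p)
Adj-sym {s} (comp refl) = comp (sym (compl-involutive s))

open Reverse {Adj} Adj-sym using (reverse; weight-reverse; ∈-reverse)

record Cycle : Set where
  constructor cycle
  field
    {from to} : Word
    path      : Path Adj from to
    closing   : Adj to from

infix 4 _∈_

_∈_ : Name → Cycle → Set
n ∈ W = n ∈ᵖ Cycle.path W

∥_∥ : Cycle → (Word → ℕ) → ℕ
∥ W ∥ f = weight f (Cycle.path W)

record Split {a b} (n : Name) (p : Path Adj a b) : Set where
  field
    {s t}  : Word
    ends   : Ends n s t
    before : Path Adj a s
    after  : Path Adj t b
    wt     : ∀ f → weight f p ≡ weight f before + weight f after
    keep   : ∀ {m} → m ∈ᵖ p → m ≡ n ⊎ (m ∈ᵖ before ⊎ m ∈ᵖ after)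

split : ∀ {a b n} {p : Path Adj a b} → n ∈ᵖ p → Split n p
split {p = _◂_ {s} (named r n e) p} here = record
  { ends = e ; before = stop s ; after = p ; wt = λ _ → refl
  ; keep = λ { here → inj₁ refl ; (there i) → inj₂ (inj₂ i) } }
split {p = _◂_ {u} c p} (there i) = record
  { ends = ends ; before = c ◂ before ; after = after
  ; wt = λ f → trans (cong (f u +_) (wt f)) (sym (+-assoc (f u) _ _))
  ; keep = λ { here → inj₂ (inj₁ here) ; (there j) → Sum.map id (Sum.map there id) (keep j) } }
  where open Split (split i)

record Opened (W : Cycle) (n : Name) (s t : Word) : Set where
  constructor opened
  field
    path : Path Adj s t
    wt   : ∀ f → weight f path ≡ ∥ W ∥ f
    keep : ∀ {m} → m ∈ W → m ≡ n ⊎ m ∈ᵖ path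

Opened-sym : ∀ {W n s t} → Opened W n s t → Opened W n t s
Opened-sym (opened p w k) = opened (reverse p) (λ f → trans (weight-reverse f p) (w f)) (Sum.map id ∈-reverse ∘ k)

-- The cycle is rotated: the part after `n`, then the closing edge as a plain step, then the part
-- before `n`.
cut : ∀ {n} W → n ∈ W → Opened W n (src n) (tgt n)
cut {n} (cycle p c) i = orient ends (opened (link after (plain c) before)
  (λ f → trans (weight-link f after (plain c) before) (trans (+-comm (weight f after) _) (sym (wt f))))
  (Sum.map id [ ∈-linkʳ after , ∈-linkˡ ]′ ∘ keep))
  where
  open Split (split i)
  orient : ∀ {s t} → Ends n s t → Opened (cycle p c) n t s → Opened (cycle p c) n (src n) (tgt n)
  orient (inj₁ (refl , refl)) o = Opened-sym o
  orient (inj₂ (refl , refl)) o = o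

cut′ : ∀ {n} W → n ∈ W → Opened W n (tgt n) (src n)
cut′ W i = Opened-sym (cut W i)

record Merged₃ (W₁ W₂ W₃ : Cycle) (n₁ n₂ n₃ : Name) : Set where
  field
    out   : Cycle
    wt    : ∀ f → ∥ out ∥ f ≡ ∥ W₁ ∥ f + ∥ W₂ ∥ f + ∥ W₃ ∥ f
    keep₁ : ∀ {m} → m ∈ W₁ → m ≡ n₁ ⊎ m ∈ out
    keep₂ : ∀ {m} → m ∈ W₂ → m ≡ n₂ ⊎ m ∈ out
    keep₃ : ∀ {m} → m ∈ W₃ → m ≡ n₃ ⊎ m ∈ out

-- The three adjacencies are the edges of a 6-cycle that alternate with the removed ones, so each
-- opened cycle is traversed once before passing to the next.
merge₃ : ∀ {W₁ W₂ W₃ n₁ n₂ n₃ a b c d e f} →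
  Opened W₁ n₁ a b → Adj b c → Opened W₂ n₂ c d → Adj d e → Opened W₃ n₃ e f → Adj f a → Merged₃ W₁ W₂ W₃ n₁ n₂ n₃
merge₃ (opened p₁ w₁ k₁) bc (opened p₂ w₂ k₂) de (opened p₃ w₃ k₃) fa = record
  { out   = cycle (link (link p₁ (plain bc) p₂) (plain de) p₃) fa
  ; wt    = λ f → trans (weight-link f (link p₁ (plain bc) p₂) _ p₃)
              (cong₂ _+_ (trans (weight-link f p₁ _ p₂) (cong₂ _+_ (w₁ f) (w₂ f))) (w₃ f))
  ; keep₁ = Sum.map id (∈-linkˡ ∘ ∈-linkˡ) ∘ k₁
  ; keep₂ = Sum.map id (∈-linkˡ ∘ ∈-linkʳ p₁) ∘ k₂
  ; keep₃ = Sum.map id (∈-linkʳ (link p₁ (plain bc) p₂)) ∘ k₃ }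

record Merged₄ (W₁ W₂ W₃ W₄ : Cycle) (n₁ n₂ n₃ n₄ : Name) : Set where
  field
    out   : Cycle
    wt    : ∀ f → ∥ out ∥ f ≡ ∥ W₁ ∥ f + ∥ W₂ ∥ f + ∥ W₃ ∥ f + ∥ W₄ ∥ f
    keep₁ : ∀ {m} → m ∈ W₁ → m ≡ n₁ ⊎ m ∈ out
    keep₂ : ∀ {m} → m ∈ W₂ → m ≡ n₂ ⊎ m ∈ out
    keep₃ : ∀ {m} → m ∈ W₃ → m ≡ n₃ ⊎ m ∈ out
    keep₄ : ∀ {m} → m ∈ W₄ → m ≡ n₄ ⊎ m ∈ out

merge₄ : ∀ {W₁ W₂ W₃ W₄ n₁ n₂ n₃ n₄ a b c d e f g h} →
  Opened W₁ n₁ a b → Adj b c → Opened W₂ n₂ c d → Adj d e → Opened W₃ n₃ e f → Adj f g → Opened W₄ n₄ g h → Adj h a →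
  Merged₄ W₁ W₂ W₃ W₄ n₁ n₂ n₃ n₄
merge₄ (opened p₁ w₁ k₁) bc (opened p₂ w₂ k₂) de (opened p₃ w₃ k₃) fg (opened p₄ w₄ k₄) ha = record
  { out   = cycle (link p₁₂₃ (plain fg) p₄) ha
  ; wt    = λ f → trans (weight-link f p₁₂₃ _ p₄) (cong₂ _+_ (trans (weight-link f p₁₂ _ p₃)
              (cong₂ _+_ (trans (weight-link f p₁ _ p₂) (cong₂ _+_ (w₁ f) (w₂ f))) (w₃ f))) (w₄ f))
  ; keep₁ = Sum.map id (∈-linkˡ ∘ ∈-linkˡ ∘ ∈-linkˡ) ∘ k₁
  ; keep₂ = Sum.map id (∈-linkˡ ∘ ∈-linkˡ ∘ ∈-linkʳ p₁) ∘ k₂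
  ; keep₃ = Sum.map id (∈-linkˡ ∘ ∈-linkʳ p₁₂) ∘ k₃
  ; keep₄ = Sum.map id (∈-linkʳ p₁₂₃) ∘ k₄ }
  where
  p₁₂  = link p₁ (plain bc) p₂
  p₁₂₃ = link p₁₂ (plain de) p₃

-- An occurrence of a subtree in a larger tree, as an embedding of words and of edge names.
record Context : Set where
  field
    κ     : Word → Word
    κ-~   : ∀ {s t} → s ~ t → κ s ~ κ t
    ν     : Tree → Edge → Name
    -- Reduces the distinctness of two edges at any depth to that of their positions in the subtree.
    ν-inj : ∀ {x y e f} → ν x e ≡ ν y f → x ≡ y × e ≡ f
    src-ν : ∀ x e → src (ν x e) ≡ κ (source x e)
    tgt-ν : ∀ x e → tgt (ν x e) ≡ κ (target x e)

  src-src : ∀ {x e y f} → source x e ~ source y f → Adj (src (ν x e)) (src (ν y f))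
  src-src {x} {e} {y} {f} p rewrite src-ν x e | src-ν y f = flip (κ-~ p)

  src-tgt : ∀ {x e y f} → source x e ~ target y f → Adj (src (ν x e)) (tgt (ν y f))
  src-tgt {x} {e} {y} {f} p rewrite src-ν x e | tgt-ν y f = flip (κ-~ p)

  tgt-src : ∀ {x e y f} → target x e ~ source y f → Adj (tgt (ν x e)) (src (ν y f))
  tgt-src {x} {e} {y} {f} p rewrite tgt-ν x e | src-ν y f = flip (κ-~ p)

  tgt-tgt : ∀ {x e y f} → target x e ~ target y f → Adj (tgt (ν x e)) (tgt (ν y f))
  tgt-tgt {x} {e} {y} {f} p rewrite tgt-ν x e | tgt-ν y f = flip (κ-~ p)

top : Context
top = record { κ = id ; κ-~ = id ; ν = _,_ ; ν-inj = λ { refl → refl , refl } ; src-ν = λ _ _ → refl ; tgt-ν = λ _ _ → refl }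

leftOfLeaf : Context → Context
leftOfLeaf Γ = record
  { κ = κ ∘ embˡ ε ; κ-~ = κ-~ ∘ embˡ-~ ε ; ν = λ y e → ν (y ▸ ε) (inˡ e)
  ; ν-inj = λ p → inj (ν-inj p)
  ; src-ν = λ y e → src-ν (y ▸ ε) (inˡ e) ; tgt-ν = λ y e → tgt-ν (y ▸ ε) (inˡ e) }
  where
  open Context Γ
  inj : ∀ {x y e f} → x ▸ ε ≡ y ▸ ε × inˡ e ≡ inˡ f → x ≡ y × e ≡ f
  inj (refl , refl) = refl , refl

-- `embʳ` complements the inner word, which preserves adjacency; edges keep their source and target
-- although `P` runs backwards through this part.
rightOf : Tree → Context → Context
rightOf a Γ = record
  { κ = κ ∘ embʳ a ; κ-~ = κ-~ ∘ embʳ-~ a ; ν = λ c e → ν (a ▸ c) (inʳ e)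
  ; ν-inj = λ p → inj (ν-inj p)
  ; src-ν = λ c e → src-ν (a ▸ c) (inʳ e) ; tgt-ν = λ c e → tgt-ν (a ▸ c) (inʳ e) }
  where
  open Context Γ
  inj : ∀ {x y e f} → a ▸ x ≡ a ▸ y × inʳ e ≡ inʳ f → x ≡ y × e ≡ f
  inj (refl , refl) = refl , refl

-- The Dyck words a1b10010, a1b10100, a1b11000 and a1b01100; hexagon and octagon below merge their cycles.
Aᵗ Bᵗ Cᵗ Zᵗ : Tree → Tree → Tree
Aᵗ a b = (a ▸ (b ▸ ε)) ▸ ε
Bᵗ a b = a ▸ ((b ▸ ε) ▸ ε)
Cᵗ a b = a ▸ (b ▸ leaf)
Zᵗ a b = (a ▸ b) ▸ leaf

-- The exchanged edges have ends of this form, so that adjacency can be checked on the last five letters.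
within : Tree → Tree → Word → Word
within a b w = coword a ++ true ∷ (word b ++ w)

module _ (a b : Tree) where

  private
    1+ : ∀ {v w} → v ≡ w → coword a ++ true ∷ v ≡ coword a ++ true ∷ w
    1+ = cong (λ r → coword a ++ true ∷ r)

  source-B : source (Bᵗ a b) close ≡ within a b (true ∷ false ∷ true ∷ false ∷ false ∷ [])
  source-B = 1+ (trans (++-assoc (word b ++ _) _ _) (++-assoc (word b) _ _))

  target-B : target (Bᵗ a b) close ≡ within a b (true ∷ false ∷ true ∷ false ∷ true ∷ [])
  target-B = 1+ (trans (cong (_++ true ∷ []) (trans (cong compl (++-assoc (coword b) _ _)) (compl-coword-++ b _))) (++-assoc (word b) _ _))

  source-C₁ : source (Cᵗ a b) (inʳ (inʳ open′)) ≡ within a b (false ∷ true ∷ true ∷ false ∷ true ∷ [])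
  source-C₁ = 1+ (trans (cong (_++ true ∷ []) (compl-coword-++ b _)) (++-assoc (word b) _ _))

  target-C₁ : target (Cᵗ a b) (inʳ (inʳ open′)) ≡ within a b (false ∷ false ∷ true ∷ false ∷ true ∷ [])
  target-C₁ = 1+ (trans (cong (_++ true ∷ []) (compl-coword-++ b _)) (++-assoc (word b) _ _))

  source-C₂ : source (Cᵗ a b) (inʳ close) ≡ within a b (false ∷ false ∷ true ∷ true ∷ true ∷ [])
  source-C₂ = 1+ (trans (cong (_++ true ∷ []) (compl-coword-++ b _)) (++-assoc (word b) _ _))

  target-C₂ : target (Cᵗ a b) (inʳ close) ≡ within a b (false ∷ false ∷ true ∷ false ∷ true ∷ [])
  target-C₂ = 1+ (trans (cong (_++ true ∷ []) (compl-coword-++ b _)) (++-assoc (word b) _ _))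

  source-Z : source (Zᵗ a b) (inˡ close) ≡ within a b (false ∷ true ∷ true ∷ false ∷ false ∷ [])
  source-Z = trans (++-assoc (coword a) _ _) (1+ (++-assoc (word b) _ _))

  target-Z : target (Zᵗ a b) (inˡ close) ≡ within a b (true ∷ true ∷ true ∷ false ∷ false ∷ [])
  target-Z = trans (++-assoc (coword a) _ _) (1+ (trans (cong (λ r → (r ++ true ∷ []) ++ _) (compl-coword b)) (++-assoc (word b) _ _)))

  source-A : source (Aᵗ a b) (inˡ (inʳ close)) ≡ within a b (false ∷ true ∷ true ∷ true ∷ false ∷ [])
  source-A = trans (++-assoc (coword a) _ _) (1+ (trans (cong (λ r → (r ++ true ∷ []) ++ _) (compl-coword-++ b _))
    (trans (++-assoc (word b ++ _) _ _) (++-assoc (word b) _ _))))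

  target-A : target (Aᵗ a b) (inˡ (inʳ close)) ≡ within a b (false ∷ false ∷ true ∷ true ∷ false ∷ [])
  target-A = trans (++-assoc (coword a) _ _) (1+ (trans (cong (λ r → (r ++ true ∷ []) ++ _) (compl-coword-++ b _))
    (trans (++-assoc (word b ++ _) _ _) (++-assoc (word b) _ _))))

  private
    ~-within : ∀ {s t v w} → s ≡ within a b v → t ≡ within a b w → v ~ w → s ~ t
    ~-within refl refl p = ~-++ˡ (coword a) (there (~-++ˡ (word b) p))

  B~C₁ : target (Bᵗ a b) close ~ target (Cᵗ a b) (inʳ (inʳ open′))
  B~C₁ = ~-within target-B target-C₁ down

  C₁~Z : source (Cᵗ a b) (inʳ (inʳ open′)) ~ source (Zᵗ a b) (inˡ close)
  C₁~Z = ~-within source-C₁ source-Z (there (there (there (there down))))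

  Z~B : target (Zᵗ a b) (inˡ close) ~ source (Bᵗ a b) close
  Z~B = ~-within target-Z source-B (there down)

  A~Z : source (Aᵗ a b) (inˡ (inʳ close)) ~ source (Zᵗ a b) (inˡ close)
  A~Z = ~-within source-A source-Z (there (there (there down)))

  B~C₂ : target (Bᵗ a b) close ~ target (Cᵗ a b) (inʳ close)
  B~C₂ = ~-within target-B target-C₂ down

  C₂~A : source (Cᵗ a b) (inʳ close) ~ target (Aᵗ a b) (inˡ (inʳ close))
  C₂~A = ~-within source-C₂ target-A (there (there (there (there down))))

-- The exchanges inside a context

module Gluing (Γ : Context) where
  open Context Γ

  nA nB nC₁ nC₂ nZ : Tree → Tree → Name
  nA a b  = ν (Aᵗ a b) (inˡ (inʳ close))
  nB a b  = ν (Bᵗ a b) close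
  nC₁ a b = ν (Cᵗ a b) (inʳ (inʳ open′))
  nC₂ a b = ν (Cᵗ a b) (inʳ close)
  nZ a b  = ν (Zᵗ a b) (inˡ close)

  -- The edge linking the group of `a` to a tree `y ▸ ε`. If `x` holds, `nZ a b` already lies on the
  -- cycle of `((a ▸ b) ▸ ε) ▸ ε`; otherwise `Aᵗ a b` provides the link.
  nL : Tree → Tree → Bool → Name
  nL a b x = if x then nZ a b else nA a b

  -- The last five letters run through 10100, 10101, 00101, 01101, 01100, 11100, flipping positions
  -- 5, 1 and 2 in turn, twice; every other flip is along a removed edge.
  hexagon : ∀ a b W₁ W₂ W₃ → nB a b ∈ W₁ → nC₁ a b ∈ W₂ → nZ a b ∈ W₃ →
    Merged₃ W₁ W₂ W₃ (nB a b) (nC₁ a b) (nZ a b)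
  hexagon a b W₁ W₂ W₃ i j k = merge₃ (cut W₁ i) (tgt-tgt (B~C₁ a b)) (cut′ W₂ j) (src-src (C₁~Z a b)) (cut W₃ k) (tgt-src (Z~B a b))

  -- The last five letters run through 10100, 10101, 00101, 00111, 00110, 01110, 01100, 11100. The
  -- edges of `Bᵗ` and `Zᵗ` are those of the hexagon; a detour through `Aᵗ` replaces the edge `nC₁`.
  octagon : ∀ a b W₁ W₂ W₃ W₄ → nB a b ∈ W₁ → nC₂ a b ∈ W₂ → nA a b ∈ W₃ → nZ a b ∈ W₄ →
    Merged₄ W₁ W₂ W₃ W₄ (nB a b) (nC₂ a b) (nA a b) (nZ a b)
  octagon a b W₁ W₂ W₃ W₄ i j k l = merge₄ (cut W₁ i) (tgt-tgt (B~C₂ a b)) (cut′ W₂ j) (src-tgt (C₂~A a b)) (cut′ W₃ k) (src-src (A~Z a b))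
    (cut W₄ l) (tgt-src (Z~B a b))

  nX nY nE : Name
  nX = ν ((leaf ▸ ε) ▸ ε) close
  nY = ν ((ε ▸ leaf) ▸ ε) (inˡ (inʳ open′))
  nE = ν (ε ▸ (ε ▸ leaf)) open′

  -- The words are 010111, 010110, 110110, 100110, 100111, 000111.
  baseHexagon : ∀ W₁ W₂ W₃ → nX ∈ W₁ → nY ∈ W₂ → nE ∈ W₃ → Merged₃ W₁ W₂ W₃ nX nY nE
  baseHexagon W₁ W₂ W₃ i j k = merge₃ (cut′ W₁ i) (src-tgt up) (cut′ W₂ j) (src-src (there (there (there (there (there up)))))) (cut W₃ k)
    (tgt-tgt (there up))

size : Tree → ℕ
size ε       = 0
size (u ▸ v) = suc (size u + size v)

-- Sums over the trees of a given size

abstract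

  -- conv k G is the sum of all G i j with i + j ≡ k.
  conv : ℕ → (ℕ → ℕ → ℕ) → ℕ
  conv zero    G = G 0 0
  conv (suc k) G = G (suc k) 0 + conv k (λ i j → G i (suc j))

  conv-cong : ∀ k {G H} → (∀ i j → i + j ≡ k → G i j ≡ H i j) → conv k G ≡ conv k H
  conv-cong zero    h = h 0 0 refl
  conv-cong (suc k) h = cong₂ _+_ (h (suc k) 0 (+-identityʳ _))
    (conv-cong k λ i j p → h i (suc j) (trans (+-suc i j) (cong suc p)))

  interchange : ∀ a b c d → (a + b) + (c + d) ≡ (a + c) + (b + d)
  interchange = solve 4 (λ a b c d → (a :+ b) :+ (c :+ d) := (a :+ c) :+ (b :+ d)) refl
    where open +-*-Solver

  conv-+ : ∀ k G H → conv k (λ i j → G i j + H i j) ≡ conv k G + conv k H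
  conv-+ zero    G H = refl
  conv-+ (suc k) G H = trans (cong (G (suc k) 0 + H (suc k) 0 +_) (conv-+ k (λ i j → G i (suc j)) λ i j → H i (suc j)))
    (interchange (G (suc k) 0) (H (suc k) 0) _ _)

  conv-zero : ∀ k {G} → (∀ i j → i + j ≡ k → G i j ≡ 0) → conv k G ≡ 0
  conv-zero zero    h = h 0 0 refl
  conv-zero (suc k) h = cong₂ _+_ (h (suc k) 0 (+-identityʳ _))
    (conv-zero k λ i j p → h i (suc j) (trans (+-suc i j) (cong suc p)))

  conv-single : ∀ i j {G} → (∀ i′ j′ → i′ + j′ ≡ i + j → i′ ≢ i → G i′ j′ ≡ 0) → conv (i + j) G ≡ G i j
  conv-single zero zero h = refl
  conv-single (suc i) zero {G} h rewrite +-identityʳ i =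
    trans (cong (G (suc i) 0 +_) (conv-zero i λ i′ j p → h i′ (suc j) (trans (+-suc i′ j) (cong suc p))
      λ { refl → m≢1+m+n i (sym p) })) (+-identityʳ _)
  conv-single i (suc j) {G} h rewrite +-suc i j =
    cong₂ _+_ (h (suc (i + j)) 0 (+-identityʳ _) λ p → m≢1+m+n i (sym p))
      (conv-single i j λ i′ j′ p → h i′ (suc j′) (trans (+-suc i′ j′) (cong suc p)))

  -- The first argument is fuel: the sizes `i` and `j` of the two parts are not structurally smaller
  -- than `suc k`.
  Sᶠ : ℕ → ℕ → (Tree → ℕ) → ℕ
  Sᶠ _       zero    F = F ε
  Sᶠ zero    (suc k) F = 0
  Sᶠ (suc n) (suc k) F = conv k λ i j → Sᶠ n i λ u → Sᶠ n j λ v → F (u ▸ v)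

  Sᶠ-cong : ∀ n k {F G} → (∀ x → size x ≡ k → F x ≡ G x) → Sᶠ n k F ≡ Sᶠ n k G
  Sᶠ-cong n       zero    h = h ε refl
  Sᶠ-cong zero    (suc k) h = refl
  Sᶠ-cong (suc n) (suc k) h = conv-cong k λ i j p → Sᶠ-cong n i λ u q → Sᶠ-cong n j λ v r →
    h (u ▸ v) (cong suc (trans (cong₂ _+_ q r) p))

  Sᶠ-fuel : ∀ m n k {F} → k ≤ m → k ≤ n → Sᶠ m k F ≡ Sᶠ n k F
  Sᶠ-fuel m       n       zero    p       q       = refl
  Sᶠ-fuel (suc m) (suc n) (suc k) (s≤s p) (s≤s q) = conv-cong k λ i j r →
    trans (Sᶠ-fuel m n i (≤-trans (m+n≤o⇒m≤o i (≤-reflexive r)) p) (≤-trans (m+n≤o⇒m≤o i (≤-reflexive r)) q))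
      (Sᶠ-cong n i λ u _ → Sᶠ-fuel m n j (≤-trans (m+n≤o⇒n≤o i (≤-reflexive r)) p) (≤-trans (m+n≤o⇒n≤o i (≤-reflexive r)) q))

  Sᶠ-+ : ∀ n k F G → Sᶠ n k (λ x → F x + G x) ≡ Sᶠ n k F + Sᶠ n k G
  Sᶠ-+ n       zero    F G = refl
  Sᶠ-+ zero    (suc k) F G = refl
  Sᶠ-+ (suc n) (suc k) F G = trans (conv-cong k λ i j _ → trans (Sᶠ-cong n i λ u _ → Sᶠ-+ n j _ _) (Sᶠ-+ n i _ _)) (conv-+ k _ _)

  Sᶠ-zero : ∀ n k {F} → (∀ x → size x ≡ k → F x ≡ 0) → Sᶠ n k F ≡ 0
  Sᶠ-zero n       zero    h = h ε refl
  Sᶠ-zero zero    (suc k) h = refl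
  Sᶠ-zero (suc n) (suc k) h = conv-zero k λ i j p → Sᶠ-zero n i λ u q → Sᶠ-zero n j λ v r →
    h (u ▸ v) (cong suc (trans (cong₂ _+_ q r) p))

  -- S k F is the sum of F over all trees of size k.
  S : ℕ → (Tree → ℕ) → ℕ
  S k = Sᶠ k k

  S-cong : ∀ k {F G} → (∀ x → size x ≡ k → F x ≡ G x) → S k F ≡ S k G
  S-cong k = Sᶠ-cong k k

  S-+ : ∀ k F G → S k (λ x → F x + G x) ≡ S k F + S k G
  S-+ k = Sᶠ-+ k k

  S-zero : ∀ k {F} → (∀ x → size x ≡ k → F x ≡ 0) → S k F ≡ 0
  S-zero k = Sᶠ-zero k k

  S-suc : ∀ k F → S (suc k) F ≡ conv k (λ i j → S i λ u → S j λ v → F (u ▸ v))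
  S-suc k F = conv-cong k λ i j r →
    trans (Sᶠ-fuel k i i (m+n≤o⇒m≤o i (≤-reflexive r)) ≤-refl)
      (Sᶠ-cong i i λ u _ → Sᶠ-fuel k j j (m+n≤o⇒n≤o i (≤-reflexive r)) ≤-refl)

  S-single : ∀ y {F} → (∀ x → size x ≡ size y → x ≢ y → F x ≡ 0) → S (size y) F ≡ F y
  S-single ε       h = refl
  S-single (u ▸ v) {F} h = trans (S-suc (size u + size v) F) (trans
    (conv-single (size u) (size v) λ i j p q → S-zero i λ u′ r → S-zero j λ v′ s →
      h (u′ ▸ v′) (cong suc (trans (cong₂ _+_ r s) p)) λ { refl → q (sym r) })
    (trans (S-single u λ u′ r q → S-zero (size v) λ v′ s → h (u′ ▸ v′) (cong suc (cong₂ _+_ r s)) λ { refl → q refl })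
      (S-single v λ v′ s q → h (u ▸ v′) (cong (λ n → suc (size u + n)) s) λ { refl → q refl })))

  S₂ : ∀ F → S 2 F ≡ F (leaf ▸ ε) + F (ε ▸ leaf)
  S₂ F = refl

  S₃ : ∀ F → S 3 F ≡ (F ((leaf ▸ ε) ▸ ε) + F ((ε ▸ leaf) ▸ ε)) + (F (leaf ▸ leaf) + (F (ε ▸ (leaf ▸ ε)) + F (ε ▸ (ε ▸ leaf))))
  S₃ F = refl

-- `R k` sums over the `u ▸ v` of size `k + 1` with `v` nonempty, `R₂ k` over those of size `k + 2`
-- with `v` of size at least 2.
R : ℕ → (Tree → ℕ) → ℕ
R zero    F = 0
R (suc k) F = conv k λ i j → S i λ u → S (suc j) λ v → F (u ▸ v)

R₂ : ℕ → (Tree → ℕ) → ℕ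
R₂ zero    F = 0
R₂ (suc k) F = conv k λ i j → S i λ u → S (2 + j) λ v → F (u ▸ v)

abstract

  S-splitε : ∀ k F → S (suc k) F ≡ S k (λ u → F (u ▸ ε)) + R k F
  S-splitε zero    F = sym (+-identityʳ _)
  S-splitε (suc k) F = S-suc (suc k) F

  R-splitleaf : ∀ k F → R (suc k) F ≡ S k (λ u → F (u ▸ leaf)) + R₂ k F
  R-splitleaf zero    F = sym (+-identityʳ _)
  R-splitleaf (suc k) F = refl

R-cong : ∀ k {F G} → (∀ u v w → F (u ▸ (v ▸ w)) ≡ G (u ▸ (v ▸ w))) → R k F ≡ R k G
R-cong zero    h = refl
R-cong (suc k) {F} {G} h = conv-cong k λ i j _ → S-cong i λ u _ → S-cong (suc j) {λ v → F (u ▸ v)} {λ v → G (u ▸ v)} λ { (v ▸ w) _ → h u v w }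

R-zero : ∀ k {F} → (∀ u v w → F (u ▸ (v ▸ w)) ≡ 0) → R k F ≡ 0
R-zero zero    h = refl
R-zero (suc k) {F} h = conv-zero k λ i j _ → S-zero i λ u _ → S-zero (suc j) {λ v → F (u ▸ v)} λ { (v ▸ w) _ → h u v w }

R₂-cong : ∀ k {F G} → (∀ u v → 2 ≤ size v → F (u ▸ v) ≡ G (u ▸ v)) → R₂ k F ≡ R₂ k G
R₂-cong zero    h = refl
R₂-cong (suc k) h = conv-cong k λ i j _ → S-cong i λ u _ → S-cong (2 + j) λ v p →
  h u v (≤-trans (m≤m+n 2 j) (≤-reflexive (sym p)))

-- Edges in use, mergers made in advance, and the induction statement

infix 4 _≟_

_≟_ : (x y : Tree) → Dec (x ≡ y)
ε ≟ ε = yes refl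
ε ≟ (_ ▸ _) = no λ ()
(_ ▸ _) ≟ ε = no λ ()
(u ▸ v) ≟ (u′ ▸ v′) = map′ (λ { (refl , refl) → refl }) (λ { refl → refl , refl }) ((u ≟ u′) ×-dec (v ≟ v′))

-- The tree whose edges all meet the root. Its cycle is the one on which surviving edges are
-- tracked, so outside cycles are attached there.
star : ℕ → Tree
star zero    = ε
star (suc k) = star k ▸ ε

size-star : ∀ k → size (star k) ≡ k
size-star zero    = refl
size-star (suc k) = cong suc (trans (+-identityʳ _) (size-star k))

-- The edges that the gluing may remove. The flag false admits the hexagon needed for size 3 when nothing has been
-- merged before; below inʳ it must not occur, since uA would then remove an edge twice.
data Used : Bool → Tree → Edge → Set where
  uˡ : ∀ {t y e} → Used false y e → Used t (y ▸ ε) (inˡ e)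
  uʳ : ∀ {t a c e} → Used true c e → Used t (a ▸ c) (inʳ e)
  uA : ∀ {t a b} → Used t (Aᵗ a b) (inˡ (inʳ close))
  uB : ∀ {t a b} → Used t (Bᵗ a b) close
  uC₁ : ∀ {t a b} → Used t (Cᵗ a b) (inʳ (inʳ open′))
  uC₂ : ∀ {t a b} → Used t (Cᵗ a b) (inʳ close)
  uZ : ∀ {t a b} → Used t (Zᵗ a b) (inˡ close)
  uX : Used false ((leaf ▸ ε) ▸ ε) close
  uY : Used false ((ε ▸ leaf) ▸ ε) (inˡ (inʳ open′))
  uE : Used false (ε ▸ (ε ▸ leaf)) open′

Used⇒Valid : ∀ {t x e} → Used t x e → Valid x e
Used⇒Valid (uˡ i) = inˡ (Used⇒Valid i)
Used⇒Valid (uʳ i) = inʳ (Used⇒Valid i)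
Used⇒Valid uA  = inˡ (inʳ close)
Used⇒Valid uB  = close
Used⇒Valid uC₁ = inʳ (inʳ open′)
Used⇒Valid uC₂ = inʳ close
Used⇒Valid uZ  = inˡ close
Used⇒Valid uX  = close
Used⇒Valid uY  = inˡ (inʳ open′)
Used⇒Valid uE  = open′

unused-leaf : ∀ {t e} → ¬ Used t leaf e
unused-leaf (uˡ ())
unused-leaf (uʳ ())

unused-A : ∀ {a b} → ¬ Used false (a ▸ (b ▸ ε)) (inʳ close)
unused-A (uʳ ())

unused-C₁ : ∀ {b} → ¬ Used true (b ▸ leaf) (inʳ open′)
unused-C₁ (uʳ ())

unused-C₂ : ∀ {b} → ¬ Used true (b ▸ leaf) close
unused-C₂ ()

-- The two shapes between which `X` records mergers. `other` admits every tree, so case analyses may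
-- have to keep the equation with `view`.
data View : Tree → Set where
  oneLeaf   : ∀ b → View (b ▸ leaf)
  twoLeaves : ∀ b → View ((b ▸ ε) ▸ ε)
  other     : ∀ x → View x

view : ∀ x → View x
view ε                     = other _
view (b ▸ (v ▸ (w ▸ z)))   = other _
view (b ▸ (ε ▸ ε))         = oneLeaf b
view (b ▸ ((v ▸ w) ▸ ε))   = other _
view (ε ▸ ε)               = other _
view ((b ▸ ε) ▸ ε)         = twoLeaves b
view ((b ▸ (v ▸ w)) ▸ ε)   = other _

-- X b says that the cycle of b ▸ leaf has already been merged into that of (b ▸ ε) ▸ ε.
ownᵛ : (Tree → Bool) → ∀ {x} → View x → Tree
ownᵛ X (oneLeaf b)   = if X b then (b ▸ ε) ▸ ε else b ▸ leaf
ownᵛ X (twoLeaves b) = (b ▸ ε) ▸ ε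
ownᵛ X (other x)     = x

own : (Tree → Bool) → Tree → Tree
own X x = ownᵛ X (view x)

skipᵛ : (Tree → Bool) → ∀ {x} → View x → Bool
skipᵛ X (oneLeaf b)   = X b
skipᵛ X (twoLeaves b) = false
skipᵛ X (other x)     = false

skip : (Tree → Bool) → Tree → Bool
skip X x = skipᵛ X (view x)

-- `X` could redirect `a ▸ c` only if `c` were `leaf`, which has no used edges.
own-right : ∀ {t c e} X a → Used t c e → own X (a ▸ c) ≡ a ▸ c
own-right {c = ε}               X a ()
own-right {c = ε ▸ ε}           X a i = contradiction i unused-leaf
own-right {c = v ▸ (w ▸ z)}     X a i = refl
own-right {c = (v ▸ w) ▸ ε}     X a i = refl

none : Tree → Bool
none _ = false

own-none : ∀ x → own none x ≡ x
own-none x with view x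
... | oneLeaf b   = refl
... | twoLeaves b = refl
... | other x     = refl

skip-none : ∀ x → skip none x ≡ false
skip-none x with view x
... | oneLeaf b   = refl
... | twoLeaves b = refl
... | other x     = refl

skip-ε : ∀ X y → skip X (y ▸ ε) ≡ false
skip-ε X ε             = refl
skip-ε X (b ▸ ε)       = refl
skip-ε X (b ▸ (v ▸ w)) = refl

skip-large : ∀ X u v → 2 ≤ size v → skip X (u ▸ v) ≡ false
skip-large X u (v ▸ (w ▸ z)) p = refl
skip-large X u ((v ▸ w) ▸ ε) p = refl
skip-large X u leaf (s≤s ())

own-ε : ∀ X y → own X (y ▸ ε) ≡ y ▸ ε
own-ε X ε             = refl
own-ε X (b ▸ ε)       = refl
own-ε X (b ▸ (v ▸ w)) = refl

term : (Tree → Bool) → (Tree → Cycle) → (Word → ℕ) → Tree → ℕ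
term X F f x = if skip X x then 0 else ∥ F x ∥ f

-- `F` gives current cycles, which may already contain much from outside the context; only the edges
-- still to be exchanged must be present.
Has : Context → Bool → (Tree → Bool) → (Tree → Cycle) → Set
Has Γ t X F = ∀ x e → Used t x e → Context.ν Γ x e ∈ F (own X x)

Removed : Context → Bool → Name → Set
Removed Γ t n = Σ Tree λ x → Σ Edge λ e → Used t x e × n ≡ Context.ν Γ x e

-- For size 2 the merger is indispensable; for size 3 it can be replaced by the base hexagon, where
-- the flag permits its edges.
Ok : ℕ → (Tree → Bool) → Bool → Set
Ok 0 X t = ⊥
Ok 1 X t = ⊥
Ok 2 X t = X ε ≡ true
Ok 3 X t = X leaf ≡ true ⊎ t ≡ false
Ok (suc (suc (suc (suc _)))) X t = ⊤

record Glued (k : ℕ) (Γ : Context) (t : Bool) (X : Tree → Bool) (F : Tree → Cycle) : Set where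
  field
    out  : Cycle
    wt   : ∀ f → ∥ out ∥ f ≡ S k (term X F f)
    -- What survives of a cycle that was fused into that of the star beforehand.
    keep : ∀ {n} → n ∈ F (star k) → n ∈ out ⊎ Removed Γ t n

Glue : ℕ → Set
Glue k = ∀ Γ t X F → Ok k X t → Has Γ t X F → Glued k Γ t X F

-- Trees of size two and three

glue₂ : Glue 2
glue₂ Γ t X F ok has = record
  { out  = F (leaf ▸ ε)
  ; wt   = λ f → sym (trans (S₂ (term X F f)) (trans (cong (λ x → ∥ F (leaf ▸ ε) ∥ f + (if x then 0 else ∥ F (ε ▸ leaf) ∥ f)) ok) (+-identityʳ _)))
  ; keep = inj₁ }

-- The five trees are `Aᵗ`, `Bᵗ`, `Cᵗ`, `Zᵗ` at `ε`, `ε` and the star. If the star has absorbed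
-- `Zᵗ`, one octagon joins everything. Otherwise a hexagon joins `Bᵗ`, `Cᵗ`, `Zᵗ`, and the base
-- hexagon joins the result, along another edge of `Cᵗ`, to the star and `Aᵗ`.
glue₃ : Glue 3
glue₃ Γ t X F ok has = by-cases (X leaf) refl ok
  where
  open Context Γ
  open Gluing Γ
  open +-*-Solver
  by-cases : ∀ x → X leaf ≡ x → Ok 3 X t → Glued 3 Γ t X F
  by-cases true eq _ = record
    { out  = out
    ; wt   = λ f → trans (wt f) (trans (trans
        (solve 4 (λ b c a z → b :+ c :+ a :+ z := (z :+ a) :+ (con 0 :+ (b :+ c))) refl (∥ F (Bᵗ ε ε) ∥ f) (∥ F (Cᵗ ε ε) ∥ f) (∥ F (Aᵗ ε ε) ∥ f) (∥ F (star 3) ∥ f))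
        (cong (λ x → (∥ F (star 3) ∥ f + ∥ F ((ε ▸ leaf) ▸ ε) ∥ f) +
          ((if x then 0 else ∥ F (leaf ▸ leaf) ∥ f) + (∥ F (ε ▸ (leaf ▸ ε)) ∥ f + ∥ F (ε ▸ (ε ▸ leaf)) ∥ f))) (sym eq))) (sym (S₃ (term X F f))))
    ; keep = [ (λ p → inj₂ (_ , _ , uZ , p)) , inj₁ ]′ ∘ keep₄ }
    where
    nZ∈ : nZ ε ε ∈ F (star 3)
    nZ∈ = subst (λ x → nZ ε ε ∈ F (if x then star 3 else leaf ▸ leaf)) eq (has _ _ uZ)
    open Merged₄ (octagon ε ε (F (Bᵗ ε ε)) (F (Cᵗ ε ε)) (F (Aᵗ ε ε)) (F (star 3)) (has _ _ uB) (has _ _ uC₂) (has _ _ uA) nZ∈)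
  by-cases false eq (inj₁ p) = contradiction (trans (sym eq) p) λ ()
  by-cases false eq (inj₂ refl) = record
    { out  = O.out
    ; wt   = λ f → trans (O.wt f) (trans (trans (cong (∥ F (star 3) ∥ f + ∥ F ((ε ▸ leaf) ▸ ε) ∥ f +_) (I.wt f)) (trans
        (solve 5 (λ x y b c z → x :+ y :+ (b :+ c :+ z) := (x :+ y) :+ (z :+ (b :+ c))) refl
          (∥ F (star 3) ∥ f) (∥ F (Aᵗ ε ε) ∥ f) (∥ F (Bᵗ ε ε) ∥ f) (∥ F (Cᵗ ε ε) ∥ f) (∥ F (Zᵗ ε ε) ∥ f))
        (cong (λ x → (∥ F (star 3) ∥ f + ∥ F ((ε ▸ leaf) ▸ ε) ∥ f) +
          ((if x then 0 else ∥ F (leaf ▸ leaf) ∥ f) + (∥ F (ε ▸ (leaf ▸ ε)) ∥ f + ∥ F (ε ▸ (ε ▸ leaf)) ∥ f))) (sym eq)))) (sym (S₃ (term X F f))))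
    ; keep = [ (λ p → inj₂ (_ , _ , uX , p)) , inj₁ ]′ ∘ O.keep₁ }
    where
    nZ∈ : nZ ε ε ∈ F (leaf ▸ leaf)
    nZ∈ = subst (λ x → nZ ε ε ∈ F (if x then star 3 else leaf ▸ leaf)) eq (has _ _ uZ)
    module I = Merged₃ (hexagon ε ε (F (Bᵗ ε ε)) (F (Cᵗ ε ε)) (F (Zᵗ ε ε)) (has _ _ uB) (has _ _ uC₁) nZ∈)
    open′≢ : nE ≢ nC₁ ε ε
    open′≢ p with ν-inj p
    ... | _ , ()
    nE∈ : nE ∈ I.out
    nE∈ = [ (λ p → contradiction p open′≢) , id ]′ (I.keep₂ (has _ _ uE))
    module O = Merged₃ (baseHexagon (F (star 3)) (F ((ε ▸ leaf) ▸ ε)) I.out (has _ _ uX) (has _ _ uY) nE∈)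

-- One group: attaching all its cycles to a cycle from outside

extent : (Tree → Bool) → (Tree → Cycle) → (Word → ℕ) → Tree → ℕ → ℕ
extent X F f a j = S (2 + j) (λ c → ∥ F (a ▸ c) ∥ f) + S j (λ b → if X (a ▸ b) then 0 else ∥ F (Zᵗ a b) ∥ f)

-- The group of `a` is what `extent` sums over, all trees of size `3 + size a + size b`. `V` is the
-- outside cycle, and the exchange at `b` is the one that reaches it.
module Group (Γ : Context) (t : Bool) (X : Tree → Bool) (F : Tree → Cycle) (has : Has Γ t X F)
  (a b : Tree) (V : Cycle) where
  open Context Γ
  open Gluing Γ

  -- Whether an exchange is made at `b′`. Away from `b` there is none if the cycle of `Zᵗ a b′` was
  -- merged before: it would link the group to the outside a second time.
  merged : ∀ {b′} → Dec (b′ ≡ b) → Bool → Bool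
  merged d x = does d ∨ not x

  -- d tells whether V takes part, x whether the cycle of Zᵗ a b′ has been merged before.
  record Fused (b′ : Tree) (d : Dec (b′ ≡ b)) (x : Bool) : Set where
    field
      out   : Cycle
      -- The second summand is the cycle of `Cᵗ a b′` when no exchange is made and it stays alone.
      wt    : ∀ f → ∥ out ∥ f + (if merged d x then 0 else ∥ F (Cᵗ a b′) ∥ f) ≡
        ∥ F (Bᵗ a b′) ∥ f + ∥ F (Cᵗ a b′) ∥ f + (if x then 0 else ∥ F (Zᵗ a b′) ∥ f) + (if does d then ∥ V ∥ f else 0)
      keepB : ∀ {m} → m ∈ F (Bᵗ a b′) → m ≡ nB a b′ ⊎ m ∈ out
      keepC : merged d x ≡ true → ∀ {m} → m ∈ F (Cᵗ a b′) → (m ≡ nC₁ a b′ ⊎ m ≡ nC₂ a b′) ⊎ m ∈ out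
      keepV : b′ ≡ b → ∀ {m} → m ∈ V → m ≡ nL a b x ⊎ m ∈ out

  -- At `b`, `V` takes the place of `Zᵗ a b` in the hexagon if it contains `nZ`; otherwise it enters
  -- an octagon along `nA`.
  fuse : ∀ b′ d x → X (a ▸ b′) ≡ x → (b′ ≡ b → nL a b x ∈ V) → Fused b′ d x
  fuse b′ (yes refl) true eq lnk = record
    { out = out ; wt = λ f → trans (+-identityʳ _) (trans (wt f) (cong (_+ ∥ V ∥ f) (sym (+-identityʳ _))))
    ; keepB = keep₁ ; keepC = λ _ → Sum.map inj₁ id ∘ keep₂ ; keepV = λ _ → keep₃ }
    where open Merged₃ (hexagon a b (F (Bᵗ a b)) (F (Cᵗ a b)) V (has _ _ uB) (has _ _ uC₁) (lnk refl))
  fuse b′ (yes refl) false eq lnk = record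
    { out = out
    ; wt = λ f → trans (+-identityʳ _) (trans (wt f) (solve 4 (λ b c v z → b :+ c :+ v :+ z := b :+ c :+ z :+ v) refl
        (∥ F (Bᵗ a b) ∥ f) (∥ F (Cᵗ a b) ∥ f) (∥ V ∥ f) (∥ F (Zᵗ a b) ∥ f)))
    ; keepB = keep₁ ; keepC = λ _ → Sum.map inj₂ id ∘ keep₂ ; keepV = λ _ → keep₃ }
    where
    open +-*-Solver
    nZ∈ : nZ a b ∈ F (Zᵗ a b)
    nZ∈ = subst (λ x → nZ a b ∈ F (if x then ((a ▸ b) ▸ ε) ▸ ε else Zᵗ a b)) eq (has _ _ uZ)
    open Merged₄ (octagon a b (F (Bᵗ a b)) (F (Cᵗ a b)) V (F (Zᵗ a b)) (has _ _ uB) (has _ _ uC₂) (lnk refl) nZ∈)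
  fuse b′ (no b′≢b) true eq lnk = record
    { out = F (Bᵗ a b′) ; wt = λ f → sym (trans (+-identityʳ _) (+-identityʳ _))
    ; keepB = inj₂ ; keepC = λ () ; keepV = λ p → contradiction p b′≢b }
  fuse b′ (no b′≢b) false eq lnk = record
    { out = out ; wt = λ f → cong (_+ 0) (wt f)
    ; keepB = keep₁ ; keepC = λ _ → Sum.map inj₁ id ∘ keep₂ ; keepV = λ p → contradiction p b′≢b }
    where
    nZ∈ : nZ a b′ ∈ F (Zᵗ a b′)
    nZ∈ = subst (λ x → nZ a b′ ∈ F (if x then ((a ▸ b′) ▸ ε) ▸ ε else Zᵗ a b′)) eq (has _ _ uZ)
    open Merged₃ (hexagon a b′ (F (Bᵗ a b′)) (F (Cᵗ a b′)) (F (Zᵗ a b′)) (has _ _ uB) (has _ _ uC₁) nZ∈)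

  module Linked (lnk : nL a b (X (a ▸ b)) ∈ V) where

    fusion : ∀ b′ → Fused b′ (b′ ≟ b) (X (a ▸ b′))
    fusion b′ = fuse b′ (b′ ≟ b) _ refl λ { refl → lnk }

    X′ : Tree → Bool
    X′ b′ = merged (b′ ≟ b) (X (a ▸ b′))

    X′-b : X′ b ≡ true
    X′-b = cong (_∨ not (X (a ▸ b))) (dec-true (b ≟ b) refl)

    F′ᵛ : ∀ {c} → View c → Cycle
    F′ᵛ (oneLeaf b′)   = F (Cᵗ a b′)
    F′ᵛ (twoLeaves b′) = Fused.out (fusion b′)
    F′ᵛ (other c)      = F (a ▸ c)

    F′ : Tree → Cycle
    F′ c = F′ᵛ (view c)

    -- From the cycle of `Cᵗ a b′` an exchange takes the edge `close` or `inʳ open′` of `b′ ▸ leaf`,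
    -- which the gluing below `inʳ` never uses; `nB` does not lie below `inʳ`.
    has′ : Has (rightOf a Γ) true X′ F′
    has′ c e u = by-view (view c) refl (subst (λ x → ν (a ▸ c) (inʳ e) ∈ F x) (own-right X a u) (has (a ▸ c) (inʳ e) (uʳ u)))
      where
      by-view : (w : View c) → view c ≡ w → ν (a ▸ c) (inʳ e) ∈ F (a ▸ c) → ν (a ▸ c) (inʳ e) ∈ F′ (ownᵛ X′ w)
      by-view (oneLeaf b′) eq i with X′ b′ in m
      ... | false = i
      ... | true with Fused.keepC (fusion b′) m i
      ...   | inj₂ j = j
      ...   | inj₁ (inj₁ p) with ν-inj p
      ...     | refl , refl = contradiction u unused-C₁
      by-view (oneLeaf b′) eq i | true | inj₁ (inj₂ p) with ν-inj p
      ...     | refl , refl = contradiction u unused-C₂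
      by-view (twoLeaves b′) eq i with Fused.keepB (fusion b′) i
      ... | inj₂ j = j
      ... | inj₁ p with ν-inj p
      ...   | _ , ()
      by-view (other _) eq i rewrite eq = i

    -- Exchanges affect only the terms of `(y ▸ ε) ▸ ε` and `y ▸ leaf`. Summing `Fused.wt` over `y`
    -- handles both, and `δ` contributes `V` once.
    wt′ : ∀ f → S (2 + size b) (term X′ F′ f) ≡ ∥ V ∥ f + extent X F f a (size b)
    wt′ f = begin
      S (2 + j) T′
        ≡⟨ trans (S-splitε (1 + j) T′) (cong₂ _+_ (S-splitε j _) (R-splitleaf j T′)) ⟩
      (S j (λ y → T′ ((y ▸ ε) ▸ ε)) + R j (λ y → T′ (y ▸ ε))) + (S j (λ y → T′ (y ▸ leaf)) + R₂ j T′)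
        ≡⟨ cong₂ (λ p q → (S j (λ y → T′ ((y ▸ ε) ▸ ε)) + p) + (S j (λ y → T′ (y ▸ leaf)) + q))
             (R-cong j {λ y → T′ (y ▸ ε)} {λ y → T (y ▸ ε)} λ _ _ _ → refl) (R₂-cong j {T′} {T} large) ⟩
      (S j (λ y → T′ ((y ▸ ε) ▸ ε)) + r) + (S j (λ y → T′ (y ▸ leaf)) + r₂)
        ≡⟨ interchange (S j (λ y → T′ ((y ▸ ε) ▸ ε))) r (S j (λ y → T′ (y ▸ leaf))) r₂ ⟩
      (S j (λ y → T′ ((y ▸ ε) ▸ ε)) + S j (λ y → T′ (y ▸ leaf))) + (r + r₂)
        ≡⟨ cong (_+ (r + r₂)) (trans (sym (S-+ j _ _)) (S-cong j λ b′ _ → Fused.wt (fusion b′) f)) ⟩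
      S j (λ y → T ((y ▸ ε) ▸ ε) + T (y ▸ leaf) + Z y + δ y) + (r + r₂)
        ≡⟨ cong (_+ (r + r₂)) (trans (S-+ j _ δ) (cong₂ _+_ (trans (S-+ j _ Z) (cong (_+ S j Z) (S-+ j _ _))) δ-sum)) ⟩
      (S j (λ y → T ((y ▸ ε) ▸ ε)) + S j (λ y → T (y ▸ leaf)) + S j Z + ∥ V ∥ f) + (r + r₂)
        ≡⟨ solve 6 (λ p q z v r s → (p :+ q :+ z :+ v) :+ (r :+ s) := v :+ (((p :+ r) :+ (q :+ s)) :+ z)) refl
             (S j (λ y → T ((y ▸ ε) ▸ ε))) (S j (λ y → T (y ▸ leaf))) (S j Z) (∥ V ∥ f) r r₂ ⟩
      ∥ V ∥ f + (((S j (λ y → T ((y ▸ ε) ▸ ε)) + r) + (S j (λ y → T (y ▸ leaf)) + r₂)) + S j Z)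
        ≡⟨ cong (λ s → ∥ V ∥ f + (s + S j Z)) (sym (trans (S-splitε (1 + j) T) (cong₂ _+_ (S-splitε j _) (R-splitleaf j T)))) ⟩
      ∥ V ∥ f + extent X F f a j ∎
      where
      open ≡-Reasoning
      open +-*-Solver
      j = size b
      T′ T Z δ : Tree → ℕ
      T′ = term X′ F′ f
      T c = ∥ F (a ▸ c) ∥ f
      Z b′ = if X (a ▸ b′) then 0 else ∥ F (Zᵗ a b′) ∥ f
      δ b′ = if does (b′ ≟ b) then ∥ V ∥ f else 0
      r = R j (λ y → T (y ▸ ε))
      r₂ = R₂ j T
      large : ∀ u v → 2 ≤ size v → T′ (u ▸ v) ≡ T (u ▸ v)
      large u (v ▸ (w ▸ z)) p = refl
      large u ((v ▸ w) ▸ ε) p = refl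
      large u leaf (s≤s ())
      δ-sum : S j δ ≡ ∥ V ∥ f
      δ-sum = trans (S-single b λ x _ x≢b → cong (if_then ∥ V ∥ f else 0) (dec-false (x ≟ b) x≢b))
        (cong (if_then ∥ V ∥ f else 0) (dec-true (b ≟ b) refl))

    record Attached : Set where
      field
        out  : Cycle
        wt   : ∀ f → ∥ out ∥ f ≡ ∥ V ∥ f + extent X F f a (size b)
        keep : ∀ {n} → n ∈ V → n ∈ out ⊎ (n ≡ nL a b (X (a ▸ b)) ⊎ Removed (rightOf a Γ) true n)

    -- `Ok` concerns `X′` at `ε` or `leaf`, the stars of size 0 and 1; then `b` is that tree, and
    -- the exchange at `b` is always made.
    Ok′ : b ≡ star (size b) → Ok (2 + size b) X′ true
    Ok′ p with size b
    ... | 0           = trans (cong X′ (sym p)) X′-b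
    ... | 1           = inj₁ (trans (cong X′ (sym p)) X′-b)
    ... | suc (suc _) = tt

    -- With `b` also `(b ▸ ε) ▸ ε` is a star, so the cycle into which `V` was fused is the one whose
    -- edges the induction hypothesis tracks.
    attach : Glue (2 + size b) → b ≡ star (size b) → Attached
    attach ih p = record
      { out  = out
      ; wt   = λ f → trans (wt f) (wt′ f)
      ; keep = λ i → [ (λ q → inj₂ (inj₁ q)) , (λ j → Sum.map id inj₂ (keep (centre j))) ]′ (Fused.keepV (fusion b) refl i) }
      where
      open Glued (ih (rightOf a Γ) true X′ F′ (Ok′ p) has′)
      centre : ∀ {n} → n ∈ Fused.out (fusion b) → n ∈ F′ (star (2 + size b))
      centre {n} = subst (λ c → n ∈ Fused.out (fusion c)) p

-- The inductive step

Ok-none : ∀ m → Ok (3 + m) none false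
Ok-none zero    = inj₂ refl
Ok-none (suc _) = tt

-- The hypothesis serves the groups, with `j` the size of `b`, and at `j = 1 + m` the trees `y` of
-- size `3 + m`.
module Large (m : ℕ) (ih : ∀ j → j ≤ 1 + m → Glue (2 + j))
  (Γ : Context) (t : Bool) (X : Tree → Bool) (F : Tree → Cycle) (has : Has Γ t X F) where
  open Context Γ
  open Gluing Γ

  starPart : (Word → ℕ) → Tree → Tree → ℕ
  starPart f a b = if does (b ≟ star (size b)) then extent X F f a (size b) else 0

  -- For every a exactly one b, the star, links the trees a ▸ c to the trees y ▸ ε: by an octagon through Aᵗ a b,
  -- or by a hexagon if the cycle of Zᵗ a b has already been merged into that of ((a ▸ b) ▸ ε) ▸ ε.
  extra : (Word → ℕ) → Tree → ℕ
  extra f ε                   = 0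
  extra f (a ▸ (b ▸ (c ▸ d))) = 0
  extra f (a ▸ (b ▸ ε))       = if X (a ▸ b) then 0 else starPart f a b
  extra f (ε ▸ ε)             = 0
  extra f ((a ▸ b) ▸ ε)       = if X (a ▸ b) then starPart f a b else 0

  record Extended (y : Tree) (g : (Word → ℕ) → ℕ) : Set where
    field
      out   : Cycle
      -- `out` is defined for every `y`, but the induction hypothesis is certain to reach the group
      -- only for this size.
      wt    : size y ≡ 3 + m → ∀ f → ∥ out ∥ f ≡ ∥ F (y ▸ ε) ∥ f + g f
      keep  : ∀ {n} → n ∈ F (y ▸ ε) → n ∈ out ⊎ Removed Γ t n
      has-y : ∀ e → Used false y e → ν (y ▸ ε) (inˡ e) ∈ out

  F-has : ∀ y e → Used false y e → ν (y ▸ ε) (inˡ e) ∈ F (y ▸ ε)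
  F-has y e u = subst (λ x → ν (y ▸ ε) (inˡ e) ∈ F x) (own-ε X y) (has (y ▸ ε) (inˡ e) (uˡ u))

  unchanged : ∀ y {g} → (size y ≡ 3 + m → ∀ f → g f ≡ 0) → Extended y g
  unchanged y h = record
    { out = F (y ▸ ε) ; wt = λ p f → sym (trans (cong (∥ F (y ▸ ε) ∥ f +_) (h p f)) (+-identityʳ _))
    ; keep = inj₁ ; has-y = F-has y }

  module _ (y a b : Tree) (small : size y ≡ 3 + m → size b ≤ 1 + m)
    (lnk : nL a b (X (a ▸ b)) ∈ F (y ▸ ε))
    (nL-removed : Removed Γ t (nL a b (X (a ▸ b))))
    (nL-unused : ∀ e → Used false y e → ν (y ▸ ε) (inˡ e) ≢ nL a b (X (a ▸ b))) where

    extend : Extended y (λ f → starPart f a b)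
    extend with b ≟ star (size b)
    ... | no _ = unchanged y λ _ _ → refl
    ... | yes p with size b ≤? 1 + m
    ...   | no ≰ = record { out = F (y ▸ ε) ; wt = λ q → contradiction (small q) ≰ ; keep = inj₁ ; has-y = F-has y }
    ...   | yes ≤ = record
      { out = out ; wt = λ _ → wt
      ; keep = λ i → Sum.map id [ (λ { refl → nL-removed }) , (λ { (c , e , u , q) → a ▸ c , inʳ e , uʳ u , q }) ]′ (keep i)
      -- The edges of `y` lie below `inˡ`, those removed inside the group below `inʳ`.
      ; has-y = λ e u → [ id , [ (λ q → contradiction q (nL-unused e u)) , (λ { (_ , _ , _ , q) → impossible q }) ]′ ]′ (keep (F-has y e u)) }
      where
      open Group.Linked Γ t X F has a b (F (y ▸ ε)) lnk using (attach; module Attached)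
      open Attached (attach (ih (size b) ≤) p)
      impossible : ∀ {x z e f} {A : Set} → ν x (inˡ e) ≡ ν z (inʳ f) → A
      impossible q with ν-inj q
      ... | _ , ()

  extended : ∀ y → Extended y (λ f → extra f y)
  extended ε                   = unchanged ε λ _ _ → refl
  extended (a ▸ (b ▸ (c ▸ d))) = unchanged _ λ _ _ → refl
  extended (ε ▸ ε)             = unchanged _ λ _ _ → refl
  -- Abstracting `extend` together with `X (a ▸ b)` turns `nL` in its type into `nA`.
  extended (a ▸ (b ▸ ε)) with X (a ▸ b) in eq | extend (a ▸ (b ▸ ε)) a b
  ... | true  | _  = unchanged _ λ _ _ → refl
  ... | false | ex = ex
    (λ p → ≤-trans (≤-reflexive (sym (+-identityʳ _))) (≤-trans (m≤n+m _ (size a)) (≤-reflexive (suc-injective (trans (sym (+-suc (size a) _)) (suc-injective p))))))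
    (has _ _ uA) (_ , _ , uA , refl)
    λ e u p → unA e u (ν-inj p)
    where
    unA : ∀ e → Used false (a ▸ (b ▸ ε)) e → Aᵗ a b ≡ Aᵗ a b × inˡ e ≡ inˡ (inʳ close) → ⊥
    unA _ u (_ , refl) = unused-A u
  extended ((a ▸ b) ▸ ε) with X (a ▸ b) in eq | extend ((a ▸ b) ▸ ε) a b
  ... | false | _  = unchanged _ λ _ _ → refl
  ... | true  | ex = ex
    (λ p → ≤-trans (m≤n+m _ (size a)) (≤-reflexive (suc-injective (trans (sym (+-identityʳ _)) (suc-injective p)))))
    (subst (λ x → nZ a b ∈ F (if x then ((a ▸ b) ▸ ε) ▸ ε else Zᵗ a b)) eq (has _ _ uZ)) (_ , _ , uZ , refl)
    λ e u p → unZ (ν-inj p)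
    where
    unZ : ∀ {y} {e : Edge} → y ▸ ε ≡ Zᵗ a b × e ≡ inˡ close → ⊥
    unZ (() , _)

  FU : Tree → Cycle
  FU y = Extended.out (extended y)

  has-FU : Has (leftOfLeaf Γ) false none FU
  has-FU y e u = subst (λ x → ν (y ▸ ε) (inˡ e) ∈ FU x) (sym (own-none y)) (Extended.has-y (extended y) e u)

  module _ (f : Word → ℕ) where

    starPart-sum : ∀ a j → S j (starPart f a) ≡ extent X F f a j
    starPart-sum a j = subst (λ i → S i (starPart f a) ≡ extent X F f a i) (size-star j) (trans
      (S-single (star j) λ b p b≢ → zero-part b (λ q → b≢ (trans q (cong star (trans p (size-star j))))))
      star-part)
      where
      zero-part : ∀ b → b ≢ star (size b) → starPart f a b ≡ 0
      zero-part b p rewrite dec-false (b ≟ star (size b)) p = refl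
      star-part : starPart f a (star j) ≡ extent X F f a (size (star j))
      star-part rewrite dec-true (star j ≟ star (size (star j))) (cong star (sym (size-star j))) = refl

    if-+ : ∀ x n → (if x then n else 0) + (if x then 0 else n) ≡ n
    if-+ true  n = +-identityʳ n
    if-+ false n = refl

    -- The trees `(a ▸ b) ▸ ε` and `a ▸ (b ▸ ε)` are both indexed by pairs, with opposite conditions
    -- on `X (a ▸ b)`, so each pair is counted once.
    extra-sum : S (3 + m) (extra f) ≡ conv (1 + m) (λ i j → S i λ a → extent X F f a j)
    extra-sum = begin
      S (3 + m) (extra f)
        ≡⟨ S-splitε (2 + m) (extra f) ⟩
      S (2 + m) (λ u → extra f (u ▸ ε)) + R (2 + m) (extra f)
        ≡⟨ cong₂ _+_ (S-suc (1 + m) _) (conv-cong (1 + m) λ i j _ → S-cong i λ a _ → trans (S-splitε j (λ v → extra f (a ▸ v)))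
             (trans (cong (S j (λ b → extra f (a ▸ (b ▸ ε))) +_) (R-zero j {λ v → extra f (a ▸ v)} λ _ _ _ → refl)) (+-identityʳ _))) ⟩
      conv (1 + m) (λ i j → S i λ a → S j λ b → if X (a ▸ b) then starPart f a b else 0) +
      conv (1 + m) (λ i j → S i λ a → S j λ b → if X (a ▸ b) then 0 else starPart f a b)
        ≡⟨ sym (conv-+ (1 + m) _ _) ⟩
      conv (1 + m) (λ i j → S i (λ a → S j λ b → if X (a ▸ b) then starPart f a b else 0) +
                            S i (λ a → S j λ b → if X (a ▸ b) then 0 else starPart f a b))
        ≡⟨ (conv-cong (1 + m) λ i j _ → trans (sym (S-+ i _ _)) (S-cong i λ a _ → trans (sym (S-+ j _ _))
             (trans (S-cong j λ b _ → if-+ (X (a ▸ b)) _) (starPart-sum a j)))) ⟩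
      conv (1 + m) (λ i j → S i λ a → extent X F f a j) ∎
      where open ≡-Reasoning

    -- In `q ▸ leaf` the tree `q` is nonempty, which makes it some `Zᵗ a b`; with the `a ▸ c` for
    -- `c` of size at least 2 these fill the groups.
    term-sum : S (4 + m) (term X F f) ≡ S (3 + m) (λ y → ∥ F (y ▸ ε) ∥ f) + conv (1 + m) (λ i j → S i λ a → extent X F f a j)
    term-sum = begin
      S (4 + m) (term X F f)
        ≡⟨ trans (S-splitε (3 + m) _) (cong (S (3 + m) (λ y → term X F f (y ▸ ε)) +_) (R-splitleaf (2 + m) (term X F f))) ⟩
      S (3 + m) (λ y → term X F f (y ▸ ε)) + (S (2 + m) (λ q → term X F f (q ▸ leaf)) + R₂ (2 + m) (term X F f))
        ≡⟨ cong₂ _+_ (S-cong (3 + m) λ y _ → cong (if_then 0 else ∥ F (y ▸ ε) ∥ f) (skip-ε X y)) (cong₂ _+_ (S-suc (1 + m) _)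
             (R₂-cong (2 + m) {term X F f} {λ x → ∥ F x ∥ f} λ u v p → cong (if_then 0 else ∥ F (u ▸ v) ∥ f) (skip-large X u v p))) ⟩
      S (3 + m) (λ y → ∥ F (y ▸ ε) ∥ f) + (conv (1 + m) (λ i j → S i λ a → S j λ b → if X (a ▸ b) then 0 else ∥ F (Zᵗ a b) ∥ f) +
                                           conv (1 + m) (λ i j → S i λ a → S (2 + j) λ c → ∥ F (a ▸ c) ∥ f))
        ≡⟨ cong (S (3 + m) (λ y → ∥ F (y ▸ ε) ∥ f) +_) (trans (sym (conv-+ (1 + m) _ _)) (conv-cong (1 + m) λ i j _ →
             trans (sym (S-+ i _ _)) (S-cong i λ a _ → +-comm (S j λ b → if X (a ▸ b) then 0 else ∥ F (Zᵗ a b) ∥ f) _))) ⟩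
      S (3 + m) (λ y → ∥ F (y ▸ ε) ∥ f) + conv (1 + m) (λ i j → S i λ a → extent X F f a j) ∎
      where open ≡-Reasoning

    FU-sum : S (3 + m) (term none FU f) ≡ S (4 + m) (term X F f)
    FU-sum = begin
      S (3 + m) (term none FU f)
        ≡⟨ S-cong (3 + m) (λ y p → trans (cong (if_then 0 else ∥ FU y ∥ f) (skip-none y)) (Extended.wt (extended y) p f)) ⟩
      S (3 + m) (λ y → ∥ F (y ▸ ε) ∥ f + extra f y)
        ≡⟨ S-+ (3 + m) _ _ ⟩
      S (3 + m) (λ y → ∥ F (y ▸ ε) ∥ f) + S (3 + m) (extra f)
        ≡⟨ cong (S (3 + m) (λ y → ∥ F (y ▸ ε) ∥ f) +_) extra-sum ⟩
      S (3 + m) (λ y → ∥ F (y ▸ ε) ∥ f) + conv (1 + m) (λ i j → S i λ a → extent X F f a j)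
        ≡⟨ sym term-sum ⟩
      S (4 + m) (term X F f) ∎
      where open ≡-Reasoning

  glued : Glued (4 + m) Γ t X F
  glued = record
    { out  = out
    ; wt   = λ f → trans (wt f) (FU-sum f)
    ; keep = λ i → [ (λ j → Sum.map id (λ { (y , e , u , q) → y ▸ ε , inˡ e , uˡ u , q }) (keep j)) , inj₂ ]′
        (Extended.keep (extended (star (3 + m))) i) }
    where open Glued (ih (1 + m) ≤-refl (leftOfLeaf Γ) false none FU (Ok-none m) has-FU)

glue : ∀ k → Glue k
glue = <-rec Glue λ
  { 0 _ _ _ _ _ ()
  ; 1 _ _ _ _ _ ()
  ; 2 _ → glue₂
  ; 3 _ → glue₃
  ; (suc (suc (suc (suc m)))) ih Γ t X F _ has → Large.glued m (λ j j≤ → ih (s≤s (s≤s (s≤s j≤)))) Γ t X F has }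

-- The paths P x visit every vertex exactly once

data On : Tree → Word → Set where
  root  : On ε []
  left  : ∀ {u s} v → On u s → On (u ▸ v) (embˡ v s)
  right : ∀ {v s} u → On v s → On (u ▸ v) (embʳ u s)
  final : ∀ u v → On (u ▸ v) (coword (u ▸ v))

embˡ-∷ʳ : ∀ v s → embˡ v s ≡ (s ++ true ∷ word v) ∷ʳ false
embˡ-∷ʳ v s = sym (++-assoc s _ _)

embʳ-∷ʳ : ∀ u s → embʳ u s ≡ (coword u ++ true ∷ compl s) ∷ʳ true
embʳ-∷ʳ u s = sym (++-assoc (coword u) _ _)

coword-∷ʳ : ∀ u v → coword (u ▸ v) ≡ (coword u ++ false ∷ coword v) ∷ʳ true
coword-∷ʳ u v = sym (++-assoc (coword u) _ _)

last-≢ : ∀ {p q v w : Word} → p ≡ v ∷ʳ false → q ≡ w ∷ʳ true → p ≢ q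
last-≢ {v = v} {w} refl refl e with ∷ʳ-injectiveʳ v w e
... | ()

embˡ-injective : ∀ v {s s′} → embˡ v s ≡ embˡ v s′ → s ≡ s′
embˡ-injective v {s} {s′} = ++-cancelʳ _ s s′

embʳ-injective : ∀ u {s s′} → embʳ u s ≡ embʳ u s′ → s ≡ s′
embʳ-injective u {s} {s′} e = trans (sym (compl-involutive s)) (trans
  (cong compl (∷ʳ-injectiveˡ (compl s) (compl s′) (∷-injectiveʳ (++-cancelˡ (coword u) _ _ e)))) (compl-involutive s′))

embʳ≢coword : ∀ u v {s} → embʳ u s ≢ coword (u ▸ v)
embʳ≢coword u v e with ++-cancelˡ (coword u) _ _ e
... | ()

weight-zero : ∀ x {f} → (∀ s → On x s → f s ≡ 0) → weight f (P x) ≡ 0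
weight-zero ε       h = h [] root
weight-zero (u ▸ v) {f} h = trans (weight-P f u v) (cong₂ _+_ (weight-zero u λ s i → h _ (left v i))
  (cong₂ _+_ (weight-zero v λ s i → h _ (right u i)) (h _ (final u v))))

weight-single : ∀ {x w} f → On x w → (∀ s → On x s → s ≢ w → f s ≡ 0) → weight f (P x) ≡ f w
weight-single f root h = refl
weight-single f (left {u} {s} v i) h = trans (weight-P f u v) (trans (cong₂ _+_
  (weight-single (λ w → f (embˡ v w)) i λ s′ j s′≢ → h _ (left v j) (s′≢ ∘ embˡ-injective v))
  (cong₂ _+_ (weight-zero v λ s′ j → h _ (right u j) (last-≢ (embˡ-∷ʳ v s) (embʳ-∷ʳ u s′) ∘ sym))
    (h _ (final u v) (last-≢ (embˡ-∷ʳ v s) (coword-∷ʳ u v) ∘ sym)))) (+-identityʳ _))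
weight-single f (right {v} {s} u i) h = trans (weight-P f u v) (trans (cong₂ _+_
  (weight-zero u λ s′ j → h _ (left v j) (last-≢ (embˡ-∷ʳ v s′) (embʳ-∷ʳ u s)))
  (cong₂ _+_ (weight-single (λ w → f (embʳ u w)) i λ s′ j s′≢ → h _ (right u j) (s′≢ ∘ embʳ-injective u))
    (h _ (final u v) (embʳ≢coword u v ∘ sym)))) (+-identityʳ _))
weight-single f (final u v) h = trans (weight-P f u v) (cong₂ _+_
  (weight-zero u λ s′ j → h _ (left v j) (last-≢ (embˡ-∷ʳ v s′) (coword-∷ʳ u v)))
  (cong (_+ f (coword (u ▸ v))) (weight-zero v λ s′ j → h _ (right u j) (embʳ≢coword u v))))

-- Reading a word from the left: reached u w is the first visit to height 1, of coword u ++ true ∷ w;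
-- stuck keeps the blocks between the record minima, the last one first.
data Reading : Set where
  reached : Tree → Word → Reading
  stuck   : Tree → List Tree → Reading

read : Tree → List Tree → Word → Reading
read c ts       []          = stuck c ts
read c ts       (false ∷ w) = read ε (c ∷ ts) w
read c []       (true ∷ w)  = reached c w
read c (d ∷ ts) (true ∷ w)  = read (d ▸ c) ts w

-- Concatenation of Dyck words.
_⊕_ : Tree → Tree → Tree
c ⊕ ε       = c
c ⊕ (u ▸ v) = (c ⊕ u) ▸ v

ε-⊕ : ∀ u → ε ⊕ u ≡ u
ε-⊕ ε       = refl
ε-⊕ (u ▸ v) = cong (_▸ v) (ε-⊕ u)

read-coword : ∀ u c ts w → read c ts (coword u ++ w) ≡ read (c ⊕ u) ts w
read-coword ε       c ts w = refl
read-coword (u ▸ v) c ts w = begin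
  read c ts ((coword u ++ false ∷ (coword v ++ true ∷ [])) ++ w)
    ≡⟨ cong (read c ts) (trans (++-assoc (coword u) _ w) (cong (λ r → coword u ++ false ∷ r) (++-assoc (coword v) _ w))) ⟩
  read c ts (coword u ++ false ∷ (coword v ++ true ∷ w))
    ≡⟨ read-coword u c ts _ ⟩
  read ε ((c ⊕ u) ∷ ts) (coword v ++ true ∷ w)
    ≡⟨ read-coword v ε _ _ ⟩
  read ((c ⊕ u) ▸ (ε ⊕ v)) ts w
    ≡⟨ cong (λ z → read ((c ⊕ u) ▸ z) ts w) (ε-⊕ v) ⟩
  read ((c ⊕ u) ▸ v) ts w ∎
  where open ≡-Reasoning

read-reached : ∀ u w → read ε [] (coword u ++ true ∷ w) ≡ reached u w
read-reached u w = trans (read-coword u ε [] _) (cong (λ z → reached z w) (ε-⊕ u))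

read-stuck : ∀ u v → read ε [] (coword u ++ false ∷ coword v) ≡ stuck v (u ∷ [])
read-stuck u v = trans (read-coword u ε [] _) (trans (cong (read ε _) (sym (++-identityʳ (coword v))))
  (trans (read-coword v ε _ []) (cong₂ (λ y z → stuck y (z ∷ [])) (ε-⊕ v) (ε-⊕ u))))

reached-injective : ∀ {u v w z} → reached u w ≡ reached v z → u ≡ v × w ≡ z
reached-injective refl = refl , refl

true-word-∷ʳ : ∀ s u v → s ++ true ∷ word (u ▸ v) ≡ ((s ++ true ∷ word u) ++ true ∷ word v) ∷ʳ false
true-word-∷ʳ s u v = trans (sym (++-assoc s _ _)) (sym (++-assoc (s ++ true ∷ word u) _ _))

∷ʳ-cancel : ∀ {p q v w : Word} {b} → p ≡ v ∷ʳ b → q ≡ w ∷ʳ b → p ≡ q → v ≡ w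
∷ʳ-cancel {v = v} {w} refl refl = ∷ʳ-injectiveˡ v w

-- The displayed 1 is the last unmatched one, since `word v` is balanced.
true-word-injective : ∀ v v′ s s′ → s ++ true ∷ word v ≡ s′ ++ true ∷ word v′ → s ≡ s′ × v ≡ v′
true-word-injective ε ε s s′ e = ∷ʳ-injectiveˡ s s′ e , refl
true-word-injective ε (u ▸ v) s s′ e = contradiction (sym e) (last-≢ (true-word-∷ʳ s′ u v) refl)
true-word-injective (u ▸ v) ε s s′ e = contradiction e (last-≢ (true-word-∷ʳ s u v) refl)
true-word-injective (u ▸ v) (u′ ▸ v′) s s′ e
  with true-word-injective v v′ _ _ (∷ʳ-cancel (true-word-∷ʳ s u v) (true-word-∷ʳ s′ u′ v′) e)
... | e′ , refl with true-word-injective u u′ s s′ e′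
...   | refl , refl = refl , refl

∷ʳ≢[] : ∀ {p w : Word} {b} → p ≡ w ∷ʳ b → p ≢ []
∷ʳ≢[] {w = []}    refl ()
∷ʳ≢[] {w = _ ∷ _} refl ()

On-nonempty : ∀ {u v w} → On (u ▸ v) w → w ≢ []
On-nonempty (left {s = s} v i)  = ∷ʳ≢[] (embˡ-∷ʳ v s)
On-nonempty (right {s = s} u i) = ∷ʳ≢[] (embʳ-∷ʳ u s)
On-nonempty (final u v)         = ∷ʳ≢[] (coword-∷ʳ u v)

-- Exactly the `left` words end in 0. Without their final 1, the `right` words reach height 1, the
-- `final` ones do not. The last unmatched 1, the first visit to height 1 or the blocks between
-- record minima then recover the parts.
On-unique : ∀ {x y w z} → On x w → On y z → w ≡ z → x ≡ y
On-unique root        root         e = refl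
On-unique {y = _ ▸ _} root       j e = contradiction (sym e) (On-nonempty j)
On-unique {_ ▸ _}     i       root e = contradiction e (On-nonempty i)
On-unique (left {s = s} v i) (left {s = s′} v′ j) e
  with true-word-injective v v′ s s′ (∷ʳ-cancel (embˡ-∷ʳ v s) (embˡ-∷ʳ v′ s′) e)
... | refl , refl with On-unique i j refl
...   | refl = refl
On-unique (left {s = s} v i) (right {s = s′} u j) e = contradiction e (last-≢ (embˡ-∷ʳ v s) (embʳ-∷ʳ u s′))
On-unique (left {s = s} v i) (final u′ v′)        e = contradiction e (last-≢ (embˡ-∷ʳ v s) (coword-∷ʳ u′ v′))
On-unique (right {s = s′} u i) (left {s = s} v j) e = contradiction (sym e) (last-≢ (embˡ-∷ʳ v s) (embʳ-∷ʳ u s′))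
On-unique (final u v) (left {s = s} v′ j)         e = contradiction (sym e) (last-≢ (embˡ-∷ʳ v′ s) (coword-∷ʳ u v))
On-unique (right {s = s} u i) (right {s = s′} u′ j) e
  with reached-injective (trans (sym (read-reached u (compl s)))
    (trans (cong (read ε []) (∷ʳ-cancel (embʳ-∷ʳ u s) (embʳ-∷ʳ u′ s′) e)) (read-reached u′ (compl s′))))
... | refl , _ with On-unique i j (embʳ-injective u e)
...   | refl = refl
On-unique (right {s = s} u i) (final u′ v′) e
  with trans (sym (read-reached u (compl s))) (trans (cong (read ε []) (∷ʳ-cancel (embʳ-∷ʳ u s) (coword-∷ʳ u′ v′) e)) (read-stuck u′ v′))
... | ()
On-unique (final u v) (right {s = s} u′ j) e
  with trans (sym (read-stuck u v)) (trans (cong (read ε []) (∷ʳ-cancel (coword-∷ʳ u v) (embʳ-∷ʳ u′ s) e)) (read-reached u′ (compl s)))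
... | ()
On-unique (final u v) (final u′ v′) e
  with trans (sym (read-stuck u v)) (trans (cong (read ε []) (∷ʳ-cancel (coword-∷ʳ u v) (coword-∷ʳ u′ v′) e)) (read-stuck u′ v′))
... | refl = refl

-- A path through every word of the two levels

ones zeros : Word → ℕ
ones []          = 0
ones (true ∷ w)  = suc (ones w)
ones (false ∷ w) = ones w
zeros []          = 0
zeros (true ∷ w)  = zeros w
zeros (false ∷ w) = suc (zeros w)

ones-++ : ∀ v w → ones (v ++ w) ≡ ones v + ones w
ones-++ []          w = refl
ones-++ (true ∷ v)  w = cong suc (ones-++ v w)
ones-++ (false ∷ v) w = ones-++ v w

zeros-++ : ∀ v w → zeros (v ++ w) ≡ zeros v + zeros w
zeros-++ []          w = refl
zeros-++ (true ∷ v)  w = zeros-++ v w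
zeros-++ (false ∷ v) w = cong suc (zeros-++ v w)

ones-compl : ∀ w → ones (compl w) ≡ zeros w
ones-compl []          = refl
ones-compl (true ∷ w)  = ones-compl w
ones-compl (false ∷ w) = cong suc (ones-compl w)

zeros-compl : ∀ w → zeros (compl w) ≡ ones w
zeros-compl []          = refl
zeros-compl (true ∷ w)  = cong suc (zeros-compl w)
zeros-compl (false ∷ w) = zeros-compl w

ones-word : ∀ x → ones (word x) ≡ size x
ones-word ε       = refl
ones-word (u ▸ v) = trans (ones-++ (word u) _) (trans (+-suc _ _) (cong suc (cong₂ _+_ (ones-word u)
  (trans (ones-++ (word v) _) (trans (+-identityʳ _) (ones-word v))))))

zeros-word : ∀ x → zeros (word x) ≡ size x
zeros-word ε       = refl
zeros-word (u ▸ v) = trans (zeros-++ (word u) _) (trans (cong₂ _+_ (zeros-word u)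
  (trans (zeros-++ (word v) _) (trans (+-comm _ 1) (cong suc (zeros-word v))))) (+-suc _ _))

ones-coword : ∀ x → ones (coword x) ≡ size x
ones-coword x = trans (cong ones (sym (compl-word x))) (trans (ones-compl (word x)) (zeros-word x))

zeros-coword : ∀ x → zeros (coword x) ≡ size x
zeros-coword x = trans (cong zeros (sym (compl-word x))) (trans (zeros-compl (word x)) (ones-word x))

-- Recording both counts also fixes the length `2 * k`.
Level : ℕ → Word → Set
Level k w = (ones w ≡ k × zeros w ≡ k) ⊎ (ones w ≡ suc k × suc (zeros w) ≡ k)

ones-embˡ : ∀ v s → ones (embˡ v s) ≡ suc (ones s + size v)
ones-embˡ v s = trans (ones-++ s _) (trans (+-suc _ _) (cong (λ n → suc (ones s + n))
  (trans (ones-++ (word v) _) (trans (+-identityʳ _) (ones-word v)))))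

zeros-embˡ : ∀ v s → zeros (embˡ v s) ≡ suc (zeros s + size v)
zeros-embˡ v s = trans (zeros-++ s _) (trans (cong (zeros s +_)
  (trans (zeros-++ (word v) _) (trans (+-comm _ 1) (cong suc (zeros-word v))))) (+-suc _ _))

ones-embʳ : ∀ u s → ones (embʳ u s) ≡ suc (suc (size u + zeros s))
ones-embʳ u s = trans (ones-++ (coword u) _) (trans (+-suc _ _) (cong suc (trans (cong₂ _+_ (ones-coword u)
  (trans (ones-++ (compl s) _) (trans (+-comm _ 1) (cong suc (ones-compl s))))) (+-suc _ _))))

zeros-embʳ : ∀ u s → zeros (embʳ u s) ≡ size u + ones s
zeros-embʳ u s = trans (zeros-++ (coword u) _) (cong₂ _+_ (zeros-coword u)
  (trans (zeros-++ (compl s) _) (trans (+-identityʳ _) (zeros-compl s))))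

On⇒Level : ∀ {x w} → On x w → Level (size x) w
On⇒Level root = inj₁ (refl , refl)
On⇒Level (left {s = s} v i) with On⇒Level i
... | inj₁ (p , q) = inj₁ (trans (ones-embˡ v s) (cong (λ n → suc (n + size v)) p) ,
                           trans (zeros-embˡ v s) (cong (λ n → suc (n + size v)) q))
... | inj₂ (p , q) = inj₂ (trans (ones-embˡ v s) (cong (λ n → suc (n + size v)) p) ,
                           trans (cong suc (zeros-embˡ v s)) (cong (λ n → suc (n + size v)) q))
On⇒Level (right {s = s} u i) with On⇒Level i
... | inj₁ (p , q) = inj₂ (trans (ones-embʳ u s) (cong (λ n → suc (suc (size u + n))) q) ,
                           cong suc (trans (zeros-embʳ u s) (cong (size u +_) p)))
... | inj₂ (p , q) = inj₁ (trans (ones-embʳ u s) (cong suc (trans (sym (+-suc _ _)) (cong (size u +_) q))) ,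
                           trans (zeros-embʳ u s) (trans (cong (size u +_) p) (+-suc _ _)))
On⇒Level (final u v) = inj₁ (ones-coword (u ▸ v) , zeros-coword (u ▸ v))

Level-embˡ : ∀ {k} v s → Level k (embˡ v s) → Σ ℕ λ i → suc (i + size v) ≡ k × Level i s
Level-embˡ v s (inj₁ (p , q)) = ones s , p′ , inj₁ (refl , +-cancelʳ-≡ (size v) _ _ (suc-injective (trans q′ (sym p′))))
  where
  p′ = trans (sym (ones-embˡ v s)) p
  q′ = trans (sym (zeros-embˡ v s)) q
Level-embˡ v s (inj₂ (p , q)) = suc (zeros s) , q′ ,
  inj₂ (+-cancelʳ-≡ (size v) _ _ (trans (suc-injective (trans (sym (ones-embˡ v s)) p)) (sym q′)) , refl)
  where q′ = trans (cong suc (sym (zeros-embˡ v s))) q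

Level-embʳ : ∀ {k} u s → Level k (embʳ u s) → Σ ℕ λ j → suc (size u + j) ≡ k × Level j s
Level-embʳ u s (inj₁ (p , q)) = suc (zeros s) , p′ ,
  inj₂ (+-cancelˡ-≡ (size u) _ _ (trans (trans (sym (zeros-embʳ u s)) q) (trans (sym p′) (sym (+-suc (size u) _)))) , refl)
  where p′ = trans (cong suc (+-suc (size u) _)) (trans (sym (ones-embʳ u s)) p)
Level-embʳ u s (inj₂ (p , q)) = ones s , q′ ,
  inj₁ (refl , +-cancelˡ-≡ (size u) _ _ (suc-injective (trans (suc-injective (trans (sym (ones-embʳ u s)) p)) (sym q′))))
  where q′ = trans (cong suc (sym (zeros-embʳ u s))) q

length-∷ʳ : ∀ (r : Word) b → length (r ∷ʳ b) ≡ suc (length r)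
length-∷ʳ r b = trans (length-++ r) (+-comm _ 1)

dropFalse : ∀ r → zeros (r ∷ʳ false) < ones (r ∷ʳ false) → suc (suc (zeros r)) ≤ ones r
dropFalse r p = subst₂ (λ z o → suc z ≤ o) (trans (zeros-++ r _) (+-comm _ 1)) (trans (ones-++ r _) (+-identityʳ _)) p

dropTrue : ∀ s v → suc (suc (zeros (s ++ true ∷ word v))) ≤ ones (s ++ true ∷ word v) → zeros s < ones s
dropTrue s v p = +-cancelʳ-≤ (size v) _ _ (≤-pred (subst₂ (λ z o → suc (suc z) ≤ o)
  (trans (zeros-++ s _) (cong (zeros s +_) (zeros-word v)))
  (trans (ones-++ s _) (trans (+-suc _ _) (cong (λ n → suc (ones s + n)) (ones-word v)))) p))

-- A final 0 is matched by the last unmatched 1 of the rest; a second search, to the left of that 1,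
-- finds the one wanted. That prefix is not a structural part of `r`, hence the bound `n`.
lastUp : ∀ n r → length r ≤ n → zeros r < ones r → Σ Word λ s → Σ Tree λ v → r ≡ s ++ true ∷ word v
lastUp n r l p with initLast r
lastUp n       .[]           l () | []
lastUp n       .(r ∷ʳ true)  l p  | r ∷ʳ′ true = r , ε , refl
lastUp zero    .(r ∷ʳ false) l p  | r ∷ʳ′ false = contradiction (subst (_≤ 0) (length-∷ʳ r false) l) λ ()
lastUp (suc n) .(r ∷ʳ false) l p  | r ∷ʳ′ false
  with l′ ← ≤-pred (subst (_≤ suc n) (length-∷ʳ r false) l) | p′ ← dropFalse r p
  with s′ , v , refl ← lastUp n r l′ (≤-trans (n≤1+n _) p′)
  with s , u , refl ← lastUp n s′ (≤-trans (≤-trans (m≤m+n _ _) (≤-reflexive (sym (length-++ s′)))) l′) (dropTrue s′ v p′)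
  = s , u ▸ v , trans (++-assoc (s ++ true ∷ word u) _ _) (++-assoc s _ _)

unstack : Tree → List Tree → Word
unstack c []       = coword c
unstack c (d ∷ ts) = unstack d ts ++ false ∷ coword c

unstack-▸ : ∀ d c ts → unstack (d ▸ c) ts ≡ unstack d ts ++ false ∷ (coword c ++ true ∷ [])
unstack-▸ d c []       = refl
unstack-▸ d c (e ∷ ts) = sym (++-assoc (unstack e ts) _ _)

unread : Reading → Word
unread (reached u w) = coword u ++ true ∷ w
unread (stuck c ts)  = unstack c ts

unread-read : ∀ c ts w → unread (read c ts w) ≡ unstack c ts ++ w
unread-read c ts       []          = sym (++-identityʳ _)
unread-read c ts       (false ∷ w) = trans (unread-read ε (c ∷ ts) w) (++-assoc (unstack c ts) _ w)
unread-read c []       (true ∷ w)  = refl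
unread-read c (d ∷ ts) (true ∷ w)  = trans (unread-read (d ▸ c) ts w) (trans (cong (_++ w) (unstack-▸ d c ts))
  (trans (++-assoc (unstack d ts) _ w) (trans (cong (λ r → unstack d ts ++ false ∷ r) (++-assoc (coword c) _ w))
    (sym (++-assoc (unstack d ts) _ _)))))

zeros-unstack : ∀ c ts → zeros (unstack c ts) ≡ ones (unstack c ts) + length ts
zeros-unstack c []       = trans (zeros-coword c) (trans (sym (ones-coword c)) (sym (+-identityʳ _)))
zeros-unstack c (d ∷ ts) = begin
  zeros (unstack d ts ++ false ∷ coword c)            ≡⟨ zeros-++ (unstack d ts) _ ⟩
  zeros (unstack d ts) + suc (zeros (coword c))       ≡⟨ cong₂ (λ m n → m + suc n) (zeros-unstack d ts) (trans (zeros-coword c) (sym (ones-coword c))) ⟩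
  ones (unstack d ts) + length ts + suc (ones (coword c))
    ≡⟨ solve 3 (λ a b c → a :+ b :+ (con 1 :+ c) := a :+ c :+ (con 1 :+ b)) refl (ones (unstack d ts)) (length ts) (ones (coword c)) ⟩
  ones (unstack d ts) + ones (coword c) + suc (length ts) ≡⟨ cong (_+ suc (length ts)) (sym (ones-++ (unstack d ts) _)) ⟩
  ones (unstack d ts ++ false ∷ coword c) + suc (length ts) ∎
  where
  open ≡-Reasoning
  open +-*-Solver

ones-∷ʳ-true : ∀ r → ones (r ∷ʳ true) ≡ suc (ones r)
ones-∷ʳ-true r = trans (ones-++ r _) (+-comm _ 1)

zeros-∷ʳ-true : ∀ r → zeros (r ∷ʳ true) ≡ zeros r
zeros-∷ʳ-true r = trans (zeros-++ r _) (+-identityʳ _)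

-- Every block in `ts` stands for an unmatched 0, so zeros exceed ones by `length ts`, and the final
-- 1 can make up for one only.
Level-unstack : ∀ {k} c ts → Level k (unstack c ts ∷ʳ true) → length ts ≡ 1
Level-unstack c ts (inj₁ (p , q)) = +-cancelˡ-≡ (ones (unstack c ts)) _ _ (begin
  ones (unstack c ts) + length ts ≡⟨ zeros-unstack c ts ⟨
  zeros (unstack c ts)            ≡⟨ trans (sym (zeros-∷ʳ-true (unstack c ts))) (trans q (sym p)) ⟩
  ones (unstack c ts ∷ʳ true)     ≡⟨ ones-++ (unstack c ts) _ ⟩
  ones (unstack c ts) + 1         ∎)
  where open ≡-Reasoning
Level-unstack c ts (inj₂ (p , q)) = contradiction
  (trans (suc-injective (trans (sym (ones-∷ʳ-true (unstack c ts))) p)) (trans (sym q) (cong suc (trans (zeros-∷ʳ-true (unstack c ts)) (zeros-unstack c ts)))))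
  (m≢1+m+n _)

Level-false : ∀ {k} r → Level k (r ∷ʳ false) → zeros r < ones r
Level-false r lv = subst₂ _≤_ (trans (zeros-++ r _) (+-comm _ 1)) (trans (ones-++ r _) (+-identityʳ _)) (zeros≤ones (r ∷ʳ false) lv)
  where
  zeros≤ones : ∀ {k} w → Level k w → zeros w ≤ ones w
  zeros≤ones w (inj₁ (refl , q)) = ≤-reflexive q
  zeros≤ones w (inj₂ (p , refl)) = ≤-trans (n≤1+n _) (≤-trans (n≤1+n _) (≤-reflexive (sym p)))

Level-coword : ∀ {k} x → Level k (coword x) → size x ≡ k
Level-coword x (inj₁ (p , _)) = trans (sym (ones-coword x)) p
Level-coword x (inj₂ (p , q)) = contradiction
  (trans (trans (sym (ones-coword x)) p) (cong suc (trans (sym q) (trans (cong suc (zeros-coword x)) (+-comm 1 _))))) (m≢1+m+n (size x))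

Level⇒On : ∀ k w → Level k w → Σ Tree λ x → size x ≡ k × On x w
Level⇒On = <-rec _ λ k rec w → by-last k rec w
  where
  Goal : ℕ → Word → Set
  Goal k w = Level k w → Σ Tree λ x → size x ≡ k × On x w
  by-last : ∀ k → (∀ {i} → i < k → ∀ w → Goal i w) → ∀ w → Goal k w
  by-last k rec w lv with initLast w
  by-last k rec .[] (inj₁ (refl , _)) | [] = ε , refl , root
  by-last k rec .(r ∷ʳ false) lv | r ∷ʳ′ false
    with s , v , refl ← lastUp (length r) r ≤-refl (Level-false r lv)
    with i , refl , lv′ ← Level-embˡ v s (subst (Level k) (sym (embˡ-∷ʳ v s)) lv)
    with u , refl , o ← rec (s≤s (m≤m+n i (size v))) s lv′
    = u ▸ v , refl , subst (On (u ▸ v)) (embˡ-∷ʳ v s) (left v o)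
  by-last k rec .(r ∷ʳ true) lv | r ∷ʳ′ true with read ε [] r | unread-read ε [] r
  ... | reached u r′ | refl
    with e ← trans (embʳ-∷ʳ u (compl r′)) (cong (λ z → (coword u ++ true ∷ z) ∷ʳ true) (compl-involutive r′))
    with j , refl , lv′ ← Level-embʳ u (compl r′) (subst (Level k) (sym e) lv)
    with v , refl , o ← rec (s≤s (m≤n+m j (size u))) (compl r′) lv′
    = u ▸ v , refl , subst (On (u ▸ v)) e (right u o)
  ... | stuck c ts | refl with ts | Level-unstack c ts lv | lv
  ...   | d ∷ [] | _ | lv′ = d ▸ c , Level-coword (d ▸ c) (subst (Level k) (sym (coword-∷ʳ d c)) lv′) , subst (On (d ▸ c)) (coword-∷ʳ d c) (final d c)

_≟ʷ_ : (v w : Word) → Dec (v ≡ w)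
_≟ʷ_ = ≡-dec _≟ᵇ_

at : Word → Word → ℕ
at w s = if does (s ≟ʷ w) then 1 else 0

at-≢ : ∀ {w s} → s ≢ w → at w s ≡ 0
at-≢ {w} {s} p rewrite dec-false (s ≟ʷ w) p = refl

at-≡ : ∀ w → at w w ≡ 1
at-≡ w rewrite dec-true (w ≟ʷ w) refl = refl

cover : ∀ {k w} → Level k w → S k (λ x → weight (at w) (P x)) ≡ 1
cover {k} {w} lv with x , refl , o ← Level⇒On k w lv =
  trans (S-single x λ y _ y≢x → weight-zero y λ s o′ → at-≢ {w} {s} λ { refl → y≢x (On-unique o′ o refl) })
    (trans (weight-single (at w) o λ s _ → at-≢ {w} {s}) (at-≡ w))

cover-zero : ∀ {k w} → ¬ Level k w → S k (λ x → weight (at w) (P x)) ≡ 0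
cover-zero {k} {w} ¬lv = S-zero k λ { x refl → weight-zero x λ s o → at-≢ {w} {s} λ { refl → ¬lv (On⇒Level o) } }

-- From words to the vertices of the odd graph

module Coerce = Transport {_~_} {Adj} id id flip (λ _ → refl) (λ _ → refl)

initial : Tree → Cycle
initial x = cycle (Coerce.path (P x)) (comp (sym (compl-coword x)))

∥initial∥ : ∀ f x → ∥ initial x ∥ f ≡ weight f (P x)
∥initial∥ f x = Coerce.weight-path f (P x)

initial-has : Has top false none initial
initial-has x e u = subst (λ y → (x , e) ∈ initial y) (sym (own-none x)) (Coerce.∈-path (∈-P (Used⇒Valid u)))

single : ∀ m → Σ Cycle λ W → ∀ f → ∥ W ∥ f ≡ S (3 + m) (λ x → weight f (P x))
single m = Glued.out G , λ f → trans (Glued.wt G f) (S-cong (3 + m) λ x _ →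
  trans (cong (if_then 0 else ∥ initial x ∥ f) (skip-none x)) (∥initial∥ f x))
  where
  G : Glued (3 + m) top false none initial
  G = glue (3 + m) top false none initial (Ok-none m) initial-has

-- Indexing the vertices of a closed walk

steps : ∀ {a b} → Path Adj a b → ℕ
steps (stop _) = 0
steps (_ ◂ p)  = suc (steps p)

visit : ∀ {a b} (p : Path Adj a b) → Fin (suc (steps p)) → Word
visit {a} p       zero    = a
visit     (_ ◂ p) (suc i) = visit p i

step-Adj : ∀ {s t} → Step Adj s t → Adj s t
step-Adj (plain r)     = r
step-Adj (named r _ _) = r

visit-next : ∀ {a b} (p : Path Adj a b) i (i< : suc (toℕ i) < suc (steps p)) → Adj (visit p i) (visit p (fromℕ< i<))
visit-next (stop _)       zero    (s≤s ())
visit-next (c ◂ stop _)   zero    (s≤s (s≤s z≤n)) = step-Adj c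
visit-next (c ◂ (_ ◂ _))  zero    (s≤s (s≤s z≤n)) = step-Adj c
visit-next (c ◂ p)        (suc i) (s≤s i<)        = visit-next p i i<

visit-last : ∀ {a b} (p : Path Adj a b) i → ¬ suc (toℕ i) < suc (steps p) → visit p i ≡ b
visit-last (stop _) zero    i≮ = refl
visit-last (c ◂ p)  zero    i≮ = contradiction (s≤s (s≤s z≤n)) i≮
visit-last (c ◂ p)  (suc i) i≮ = visit-last p i (i≮ ∘ s≤s)

visit-cyclicSuc : ∀ W (i : Fin (suc (steps (Cycle.path W)))) → Adj (visit (Cycle.path W) i) (visit (Cycle.path W) (cyclicSuc i))
visit-cyclicSuc (cycle p c) i with suc (toℕ i) <? suc (steps p)
... | yes i< = visit-next p i i<
... | no i≮  = subst (λ w → Adj w _) (sym (visit-last p i i≮)) c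

visited : ∀ {a b} (p : Path Adj a b) i → 1 ≤ weight (at (visit p i)) p
visited {a} (stop _) zero    = ≤-reflexive (sym (at-≡ a))
visited {a} (c ◂ p)  zero    = ≤-trans (≤-reflexive (sym (at-≡ a))) (m≤m+n _ _)
visited     (c ◂ p)  (suc i) = ≤-trans (visited p i) (m≤n+m _ _)

visit-injective : ∀ {a b} (p : Path Adj a b) → (∀ w → weight (at w) p ≤ 1) → ∀ i j → visit p i ≡ visit p j → i ≡ j
visit-injective p       h zero    zero    e = refl
visit-injective {a} (c ◂ p) h zero    (suc j) e =
  contradiction (≤-trans (+-mono-≤ (≤-reflexive (sym (at-≡ a))) (subst (λ w → 1 ≤ weight (at w) p) (sym e) (visited p j))) (h a)) λ { (s≤s ()) }
visit-injective {a} (c ◂ p) h (suc i) zero    e =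
  contradiction (≤-trans (+-mono-≤ (≤-reflexive (sym (at-≡ a))) (subst (λ w → 1 ≤ weight (at w) p) e (visited p i))) (h a)) λ { (s≤s ()) }
visit-injective (c ◂ p) h (suc i) (suc j) e = cong suc (visit-injective p (λ w → ≤-trans (m≤n+m _ _) (h w)) i j e)

visit-surjective : ∀ {a b} (p : Path Adj a b) w → 1 ≤ weight (at w) p → Σ (Fin (suc (steps p))) λ i → visit p i ≡ w
visit-surjective {a} (stop _) w h with a ≟ʷ w
... | yes e = zero , e
... | no _  = contradiction h λ ()
visit-surjective {a} (c ◂ p) w h with a ≟ʷ w
... | yes e = zero , e
... | no _  with i , e ← visit-surjective p w h = suc i , e

weight-one : ∀ {a b} (p : Path Adj a b) → weight (λ _ → 1) p ≡ suc (steps p)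
weight-one (stop _) = refl
weight-one (c ◂ p)  = cong suc (weight-one p)

S-≥ : ∀ y F → F y ≤ S (size y) F
S-≥ y F = subst₂ _≤_
  (trans (S-single y (λ x _ x≢y → on-≢ x x≢y)) on-≡)
  (trans (sym (S-+ (size y) on off)) (S-cong (size y) λ x _ → on+off x))
  (m≤m+n (S (size y) on) (S (size y) off))
  where
  on off : Tree → ℕ
  on x  = if does (x ≟ y) then F x else 0
  off x = if does (x ≟ y) then 0 else F x
  on-≢ : ∀ x → x ≢ y → on x ≡ 0
  on-≢ x p = cong (if_then F x else 0) (dec-false (x ≟ y) p)
  on-≡ : on y ≡ F y
  on-≡ = cong (if_then F y else 0) (dec-true (y ≟ y) refl)
  on+off : ∀ x → on x + off x ≡ F x
  on+off x with does (x ≟ y)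
  ... | true  = +-identityʳ _
  ... | false = refl

weight-one-≥ : ∀ {R a b} (p : Path R a b) → 1 ≤ weight (λ _ → 1) p
weight-one-≥ (stop _) = ≤-refl
weight-one-≥ (_ ◂ _)  = s≤s z≤n

Level? : ∀ k w → Dec (Level k w)
Level? k w = ((ones w ℕ.≟ k) ×-dec (zeros w ℕ.≟ k)) ⊎-dec ((ones w ℕ.≟ suc k) ×-dec (suc (zeros w) ℕ.≟ k))

ones+zeros : ∀ w → ones w + zeros w ≡ length w
ones+zeros []          = refl
ones+zeros (true ∷ w)  = cong suc (ones+zeros w)
ones+zeros (false ∷ w) = trans (+-suc _ _) (cong suc (ones+zeros w))

Level-length : ∀ {k} w → Level k w → length w ≡ 2 * k
Level-length {k} w (inj₁ (p , q)) = trans (sym (ones+zeros w)) (trans (cong₂ _+_ p q) (cong (k +_) (sym (+-identityʳ k))))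
Level-length {k} w (inj₂ (p , q)) = trans (sym (ones+zeros w)) (trans (cong (_+ zeros w) p)
  (trans (sym (+-suc k (zeros w))) (trans (cong (k +_) q) (cong (k +_) (sym (+-identityʳ k))))))

length-compl : ∀ w → length (compl w) ≡ length w
length-compl []      = refl
length-compl (b ∷ w) = cong suc (length-compl w)

-- Words as subsets

toVec : ∀ w {n} → length w ≡ n → Vec Bool n
toVec []      {zero}  p = []
toVec (b ∷ w) {suc n} p = b ∷ toVec w (suc-injective p)

∣toVec∣ : ∀ w {n} (p : length w ≡ n) → ∣ toVec w p ∣ ≡ ones w
∣toVec∣ []          {zero}  p = refl
∣toVec∣ (true ∷ w)  {suc n} p = cong suc (∣toVec∣ w (suc-injective p))
∣toVec∣ (false ∷ w) {suc n} p = ∣toVec∣ w (suc-injective p)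

toVec-injective : ∀ v w {n} (p : length v ≡ n) (q : length w ≡ n) → toVec v p ≡ toVec w q → v ≡ w
toVec-injective []      []      {zero}  p q e = refl
toVec-injective (b ∷ v) (c ∷ w) {suc n} p q e = cong₂ _∷_ (Vec.∷-injectiveˡ e)
  (toVec-injective v w (suc-injective p) (suc-injective q) (Vec.∷-injectiveʳ e))

toVec-toList : ∀ {n} (s : Vec Bool n) (p : length (Vec.toList s) ≡ n) → toVec (Vec.toList s) p ≡ s
toVec-toList []      p = refl
toVec-toList (b ∷ s) p = cong (b ∷_) (toVec-toList s (suc-injective p))

ones-toList : ∀ {n} (s : Vec Bool n) → ones (Vec.toList s) ≡ ∣ s ∣
ones-toList []          = refl
ones-toList (true ∷ s)  = cong suc (ones-toList s)
ones-toList (false ∷ s) = ones-toList s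

-- The word w of weight k becomes the set w 0, the word w of weight k + 1 becomes the set w̄ 1
-- (with the additional coordinate in front).
vertexSet : ∀ {k} w → Level k w → Subset (suc (2 * k))
vertexSet w lv@(inj₁ _) = false ∷ toVec w (Level-length w lv)
vertexSet w lv@(inj₂ _) = true ∷ toVec (compl w) (trans (length-compl w) (Level-length w lv))

∣vertexSet∣ : ∀ {k} w (lv : Level k w) → ∣ vertexSet w lv ∣ ≡ k
∣vertexSet∣ w lv@(inj₁ (p , q)) = trans (∣toVec∣ w (Level-length w lv)) p
∣vertexSet∣ w lv@(inj₂ (p , q)) = trans (cong suc (trans (∣toVec∣ (compl w) _) (ones-compl w))) q

vertexSet-injective : ∀ {k} v w (lv : Level k v) (lw : Level k w) → vertexSet v lv ≡ vertexSet w lw → v ≡ w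
vertexSet-injective v w (inj₁ _) (inj₁ _) e = toVec-injective v w _ _ (Vec.∷-injectiveʳ e)
vertexSet-injective v w (inj₂ _) (inj₂ _) e = trans (sym (compl-involutive v))
  (trans (cong compl (toVec-injective (compl v) (compl w) _ _ (Vec.∷-injectiveʳ e))) (compl-involutive w))

vertexSet-irrelevant : ∀ {k} w (l l′ : Level k w) → vertexSet w l ≡ vertexSet w l′
vertexSet-irrelevant w l@(inj₁ _) l′@(inj₁ _) = cong (λ p → false ∷ toVec w p) (≡-irrelevant (Level-length w l) (Level-length w l′))
vertexSet-irrelevant w (inj₁ (refl , _)) (inj₂ (q , _)) = contradiction (sym q) 1+n≢n
vertexSet-irrelevant w (inj₂ (q , _)) (inj₁ (refl , _)) = contradiction (sym q) 1+n≢n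
vertexSet-irrelevant w (inj₂ (p , q)) (inj₂ (p′ , q′)) = cong (λ e → true ∷ toVec (compl w) e) (≡-irrelevant _ _)

infix 4 _⊑_

data _⊑_ : Word → Word → Set where
  []    : [] ⊑ []
  both  : ∀ {b v w} → v ⊑ w → b ∷ v ⊑ b ∷ w
  raise : ∀ {v w} → v ⊑ w → false ∷ v ⊑ true ∷ w

⊑-refl : ∀ w → w ⊑ w
⊑-refl []      = []
⊑-refl (b ∷ w) = both (⊑-refl w)

~⇒⊑ : ∀ {v w} → v ~ w → (ones w ≡ suc (ones v) × v ⊑ w) ⊎ (ones v ≡ suc (ones w) × w ⊑ v)
~⇒⊑ up   = inj₁ (refl , raise (⊑-refl _))
~⇒⊑ down = inj₂ (refl , raise (⊑-refl _))
~⇒⊑ (there {true} p) with ~⇒⊑ p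
... | inj₁ (e , q) = inj₁ (cong suc e , both q)
... | inj₂ (e , q) = inj₂ (cong suc e , both q)
~⇒⊑ (there {false} p) with ~⇒⊑ p
... | inj₁ (e , q) = inj₁ (e , both q)
... | inj₂ (e , q) = inj₂ (e , both q)

toVec-disjoint : ∀ {v w n} (p : length v ≡ n) (q : length (compl w) ≡ n) → v ⊑ w → toVec v p ∩ toVec (compl w) q ≡ Subset.⊥
toVec-disjoint {n = zero}  p q []                = refl
toVec-disjoint {n = suc n} p q (both {true} i)  = cong (false ∷_) (toVec-disjoint _ _ i)
toVec-disjoint {n = suc n} p q (both {false} i) = cong (false ∷_) (toVec-disjoint _ _ i)
toVec-disjoint {n = suc n} p q (raise i)         = cong (false ∷_) (toVec-disjoint _ _ i)

-- Complements stay in the lower level and flips pass between the levels; counting ones excludes the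
-- rest. If `v ⊑ w`, then `v` misses the complement of `w`, and at most one of the sets has the
-- additional coordinate.
vertexSet-disjoint : ∀ {k} v w (lv : Level k v) (lw : Level k w) → Adj v w → vertexSet v lv ∩ vertexSet w lw ≡ Subset.⊥
vertexSet-disjoint v .(compl v) (inj₁ _) (inj₁ _) (comp refl) = cong (false ∷_) (toVec-disjoint _ _ (⊑-refl v))
vertexSet-disjoint v .(compl v) (inj₁ (p , q)) (inj₂ (p′ , _)) (comp refl) =
  contradiction (trans (sym p′) (trans (ones-compl v) q)) 1+n≢n
vertexSet-disjoint v .(compl v) (inj₂ (p , q)) (inj₁ (p′ , _)) (comp refl) =
  contradiction (trans q (trans (sym p′) (ones-compl v))) 1+n≢n
vertexSet-disjoint v .(compl v) (inj₂ (p , q)) (inj₂ (p′ , _)) (comp refl) =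
  contradiction (trans (cong suc q) (trans (sym p′) (ones-compl v))) (m+1+n≢n 1)
vertexSet-disjoint v w (inj₁ (p , _)) (inj₁ (q , _)) (flip r) with ~⇒⊑ r
... | inj₁ (e , _) = contradiction (trans (sym e) (trans q (sym p))) 1+n≢n
... | inj₂ (e , _) = contradiction (trans (sym e) (trans p (sym q))) 1+n≢n
vertexSet-disjoint v w (inj₁ (p , _)) (inj₂ (q , _)) (flip r) with ~⇒⊑ r
... | inj₁ (_ , i) = cong (false ∷_) (toVec-disjoint _ _ i)
... | inj₂ (e , _) = contradiction (trans (sym (trans e (cong suc q))) p) (m+1+n≢n 1)
vertexSet-disjoint v w (inj₂ (p , _)) (inj₁ (q , _)) (flip r) with ~⇒⊑ r
... | inj₁ (e , _) = contradiction (trans (sym (trans e (cong suc p))) q) (m+1+n≢n 1)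
... | inj₂ (_ , i) = cong (false ∷_) (trans (∩-comm (toVec (compl v) _) (toVec w _)) (toVec-disjoint _ _ i))
vertexSet-disjoint v w (inj₂ (p , _)) (inj₂ (q , _)) (flip r) with ~⇒⊑ r
... | inj₁ (e , _) = contradiction (trans (sym e) (trans q (sym p))) 1+n≢n
... | inj₂ (e , _) = contradiction (trans (sym e) (trans p (sym q))) 1+n≢n

Vertex : ℕ → Set
Vertex k = Graph.Vertex (OddGraph k)

vertex-≡ : ∀ {k} {u v : Vertex k} → proj₁ u ≡ proj₁ v → u ≡ v
vertex-≡ {u = s , p} {.s , q} refl = cong (s ,_) (≡-irrelevant p q)

vertexSet-surjective : ∀ {k} (v : Vertex k) → Σ Word λ w → Σ (Level k w) λ lv → vertexSet w lv ≡ proj₁ v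
vertexSet-surjective {k} (false ∷ s , p) = w , lv , cong (false ∷_) (toVec-toList s _)
  where
  w = Vec.toList s
  ones-w : ones w ≡ k
  ones-w = trans (ones-toList s) p
  lv : Level k w
  lv = inj₁ (ones-w , +-cancelˡ-≡ k _ _ (trans (cong (_+ zeros w) (sym ones-w))
    (trans (ones+zeros w) (trans (Vec.length-toList s) (cong (k +_) (+-identityʳ k))))))
vertexSet-surjective {k} (true ∷ s , p) = compl w , lv ,
  cong (true ∷_) (trans (toVec-cong (compl-involutive w)) (toVec-toList s (Vec.length-toList s)))
  where
  w = Vec.toList s
  toVec-cong : ∀ {v w n} {p : length v ≡ n} {q : length w ≡ n} → v ≡ w → toVec v p ≡ toVec w q
  toVec-cong {v} refl = cong (toVec v) (≡-irrelevant _ _)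
  ones-w : suc (ones w) ≡ k
  ones-w = trans (cong suc (ones-toList s)) p
  lv : Level k (compl w)
  lv = inj₂ (trans (ones-compl w) (+-cancelˡ-≡ k _ _ (trans (cong (_+ zeros w) (sym ones-w))
    (trans (cong suc (trans (ones+zeros w) (trans (Vec.length-toList s) (cong (k +_) (+-identityʳ k))))) (sym (+-suc k k))))) , trans (cong suc (zeros-compl w)) ones-w)

hamiltonCycle : ∀ m → HamiltonCycle (OddGraph (3 + m))
hamiltonCycle m = record
  { len        = suc (steps path)
  ; len≥3      = long
  ; vert       = λ i → vertexSet (visit path i) (level i) , ∣vertexSet∣ (visit path i) (level i)
  ; injective  = λ i j e → visit-injective path at-most-one i j
      (vertexSet-injective (visit path i) (visit path j) (level i) (level j) (cong proj₁ e))
  ; surjective = surj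
  ; adjacent   = λ i (x , x∈) → ∉⊥ (subst (x Subset.∈_)
      (vertexSet-disjoint _ _ (level i) (level (cyclicSuc i)) (visit-cyclicSuc W i)) x∈)
  }
  where
  k = 3 + m
  W = proj₁ (single m)
  open Cycle W
  long : 3 ≤ suc (steps path)
  long = begin
    -- The path of `star k` is an image of that of `star (2 + m)` followed by two more vertices.
    3                                            ≤⟨ +-monoˡ-≤ 2 (weight-one-≥ (P (star (2 + m)))) ⟩
    weight (λ _ → 1) (P (star (2 + m))) + 2      ≡⟨ weight-P (λ _ → 1) (star (2 + m)) ε ⟨
    weight (λ _ → 1) (P (star k))                ≤⟨ S-≥ (star k) (λ x → weight (λ _ → 1) (P x)) ⟩
    S (size (star k)) (λ x → weight (λ _ → 1) (P x)) ≡⟨ cong (λ n → S n (λ x → weight (λ _ → 1) (P x))) (size-star k) ⟩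
    S k (λ x → weight (λ _ → 1) (P x))           ≡⟨ proj₂ (single m) (λ _ → 1) ⟨
    weight (λ _ → 1) path                        ≡⟨ weight-one path ⟩
    suc (steps path)                             ∎
    where open ≤-Reasoning
  visits : ∀ {w} → Level k w → weight (at w) path ≡ 1
  visits {w} lv = trans (proj₂ (single m) (at w)) (cover lv)
  visits-zero : ∀ {w} → ¬ Level k w → weight (at w) path ≡ 0
  visits-zero {w} lv = trans (proj₂ (single m) (at w)) (cover-zero lv)
  at-most-one : ∀ w → weight (at w) path ≤ 1
  at-most-one w with Level? k w
  ... | yes lv = ≤-reflexive (visits lv)
  ... | no ¬lv = ≤-trans (≤-reflexive (visits-zero ¬lv)) z≤n
  level : ∀ i → Level k (visit path i)
  level i with Level? k (visit path i)
  ... | yes lv = lv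
  ... | no ¬lv = contradiction (≤-trans (visited path i) (≤-reflexive (visits-zero ¬lv))) λ ()
  surj : (v : Vertex k) → Σ (Fin (suc (steps path))) λ i → (vertexSet (visit path i) (level i) , ∣vertexSet∣ (visit path i) (level i)) ≡ v
  surj v with w , lv , e ← vertexSet-surjective v with i , refl ← visit-surjective path w (≤-reflexive (sym (visits lv)))
    = i , vertex-≡ (trans (vertexSet-irrelevant w (level i) lv) e)

theorem1 : (k : ℕ) → 3 ≤ k → HamiltonCycle (OddGraph k)
theorem1 (suc (suc (suc m))) (s≤s (s≤s (s≤s z≤n))) = hamiltonCycle m
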